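{- Let $G$ be a graph that is determined by spectrum and whose characteristic polynomial $P_G$ is irreducible over $\mathbb{Q}$. Then every vertex of $G$ is decisive.
   Context: All graphs are finite, simple and undirected. For a graph $G$ with adjacency matrix $A$, $P_G(z)=\det(zI-A)$ is its characteristic polynomial. A graph $G$ is determined by spectrum if, for every graph $H$, $P_G=P_H$ implies $G\cong H$. A walk of length $k$ starting at a vertex $v$ in a graph $G$ is a sequence of vertices $v=v_0,v_1,\ldots,v_k$ such that every two successive vertices are adjacent; it is closed if $v_0=v_k$. Let $w_G^k(v)$ be the number of walks of length $k$ in $G$ starting at $v$, and $r_G^k(v)$ the number of closed walks of length $k$ in $G$ starting (and ending) at $v$. Put $W_G(v)=(w_G^1(v),w_G^2(v),\ldots)$ and $R_G(v)=(r_G^1(v),r_G^2(v),\ldots)$. $G_v$ denotes the graph $G$ rooted at $v$; $G_v\cong H_u$ means that there is an isomorphism from $G$ to $H$ taking $v$ to $u$. For $I\in\{W,R\}$, a vertex $v$ of a connected $n$-vertex graph $G$ is $I$-decisive if for every connected $n$-vertex graph $H$ and every $u\in V(H)$, the equality $I_G(v)=I_H(u)$ implies $G_v\cong H_u$. A vertex is decisive if it is both $W$-decisive and $R$-decisive. (A graph with irreducible characteristic polynomial is automatically connected.) -}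

module Defs where

open import Algebra.Bundles.Raw using (RawRing)
import Algebra.Definitions.RawSemiring as RawSemiringDefinitions
open import Data.Fin using (Fin; zero; suc; toℕ; _≟_)
open import Data.Fin.Permutation using (Permutation; _⟨$⟩ʳ_)
open import Data.List as List using (List; []; _∷_; cartesianProductWith; allFin; filter; length)
open import Data.Nat using (ℕ; zero; suc)
open import Data.Product using (Σ-syntax; _×_)
open import Data.Rational as ℚ using (ℚ; 0ℚ; 1ℚ)
open import Data.Vec as Vec using (Vec; []; _∷_)
open import Data.Vec.Functional using (Vector; removeAt)
open import Data.Vec.Relation.Unary.Linked using (linked?)
open import Function using (_⇔_)
open import Level using (0ℓ)
open import Relation.Binary using (Rel; Decidable; Symmetric; Irreflexive)
open import Relation.Binary.Construct.Closure.ReflexiveTransitive using (Star)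
open import Relation.Binary.PropositionalEquality using (_≡_; _≗_)
open import Relation.Nullary using (yes; no)
open import Relation.Nullary.Decidable using (_×-dec_)

private
  variable
    m n : ℕ

------------------------------------------------------------------------
-- Polynomials over ℚ, as lists of coefficients in increasing degree.
-- Trailing zeros are allowed, so the ring equality is equality of all
-- coefficients rather than _≡_ on lists.

Poly : Set
Poly = List ℚ

coeff : Poly → ℕ → ℚ
coeff []      _       = 0ℚ
coeff (a ∷ p) zero    = a
coeff (a ∷ p) (suc k) = coeff p k

infix  4 _≈ₚ_
infixl 6 _+ₚ_
infixl 7 _*ₚ_
infix  8 -ₚ_

_≈ₚ_ : Rel Poly 0ℓ
p ≈ₚ q = coeff p ≗ coeff q

_+ₚ_ : Poly → Poly → Poly
[]      +ₚ q       = q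
(a ∷ p) +ₚ []      = a ∷ p
(a ∷ p) +ₚ (b ∷ q) = (a ℚ.+ b) ∷ (p +ₚ q)

-ₚ_ : Poly → Poly
-ₚ_ = List.map (λ a → ℚ.- a)

-- (a + z p) q = a q + z (p q)
_*ₚ_ : Poly → Poly → Poly
[]      *ₚ q = []
(a ∷ p) *ₚ q = List.map (a ℚ.*_) q +ₚ (0ℚ ∷ p *ₚ q)

const : ℚ → Poly
const a = a ∷ []

𝐳 : Poly
𝐳 = 0ℚ ∷ 1ℚ ∷ []

ℚ[z] : RawRing 0ℓ 0ℓ
ℚ[z] = record
  { Carrier = Poly
  ; _≈_     = _≈ₚ_
  ; _+_     = _+ₚ_
  ; _*_     = _*ₚ_
  ; -_      = -ₚ_
  ; 0#      = []
  ; 1#      = const 1ℚ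
  }

-- Excludes units by p∤1 and excludes 0 by its factorisation 0 = 0 * 0
-- into non-units.
IrreducibleOverℚ : Poly → Set
IrreducibleOverℚ = RawSemiringDefinitions.Irreducible (RawRing.rawSemiring ℚ[z])

------------------------------------------------------------------------
-- Matrices and determinants

Matrix : Set → ℕ → Set
Matrix A n = Vector (Vector A n) n

module Determinant (R : RawRing 0ℓ 0ℓ) where
  open RawRing R
  open RawSemiringDefinitions rawSemiring using (sum; _^_)

  -- Laplace expansion along the first row.
  det : Matrix Carrier n → Carrier
  det {zero}  M = 1#
  det {suc n} M =
    sum λ j → (- 1#) ^ toℕ j * (M zero j * det (λ i → removeAt (M (suc i)) j))

open Determinant ℚ[z] public using (det)

identity : Matrix ℚ n
identity i j with i ≟ j
... | yes _ = 1ℚ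
... | no  _ = 0ℚ

-- det (z I − M)
charPoly : Matrix ℚ n → Poly
charPoly M = det λ i j → 𝐳 *ₚ const (identity i j) +ₚ -ₚ const (M i j)

------------------------------------------------------------------------
-- Finite simple graphs on the vertex set Fin n

record Graph (n : ℕ) : Set₁ where
  infix 4 _~_ _~?_
  field
    _~_    : Rel (Fin n) 0ℓ
    _~?_   : Decidable _~_
    sym    : Symmetric _~_
    irrefl : Irreflexive _≡_ _~_

  adjacency : Matrix ℚ n
  adjacency i j with i ~? j
  ... | yes _ = 1ℚ
  ... | no  _ = 0ℚ

  Connected : Set
  Connected = ∀ u v → Star _~_ u v

open Graph using (adjacency; Connected)

P[_] : Graph n → Poly
P[ G ] = charPoly (adjacency G)

record _≅_ (G : Graph m) (H : Graph n) : Set where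
  private
    module G = Graph G
    module H = Graph H
  field
    bijection : Permutation m n
    adjacent  : ∀ u v → (u G.~ v) ⇔ ((bijection ⟨$⟩ʳ u) H.~ (bijection ⟨$⟩ʳ v))

  to : Fin m → Fin n
  to = bijection ⟨$⟩ʳ_

RootedIso : (G : Graph m) → Fin m → (H : Graph n) → Fin n → Set
RootedIso G v H u = Σ[ φ ∈ G ≅ H ] _≅_.to φ v ≡ u

DeterminedBySpectrum : Graph n → Set₁
DeterminedBySpectrum G = ∀ {m} (H : Graph m) → P[ G ] ≈ₚ P[ H ] → G ≅ H

------------------------------------------------------------------------
-- Walks

-- Every vector of the given length, exactly once.
allVecs : ∀ n k → List (Vec (Fin n) k)
allVecs n zero    = [] ∷ []
allVecs n (suc k) = cartesianProductWith _∷_ (allFin n) (allVecs n k)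

module _ (G : Graph n) where
  open Graph G

  -- A walk of length k is the vector of its k + 1 vertices.
  walksFrom : Fin n → ∀ k → List (Vec (Fin n) (suc k))
  walksFrom v k =
    filter (λ vs → linked? _~?_ vs ×-dec (Vec.head vs ≟ v)) (allVecs n (suc k))

  closedWalksFrom : Fin n → ∀ k → List (Vec (Fin n) (suc k))
  closedWalksFrom v k = filter (λ vs → Vec.last vs ≟ v) (walksFrom v k)

-- The sequences of numbers of walks are indexed from length 1, so the
-- entry at index k counts walks of length k + 1.
WalkSequence : Set₁
WalkSequence = ∀ {n} → Graph n → Fin n → ℕ → ℕ

W : WalkSequence
W G v k = length (walksFrom G v (suc k))

R : WalkSequence
R G v k = length (closedWalksFrom G v (suc k))

-- The notion is defined for vertices of connected graphs only, so
-- connectedness of G is part of it.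
Decisive[_] : WalkSequence → (G : Graph n) → Fin n → Set₁
Decisive[_] {n} I G v =
  Connected G ×
  (∀ (H : Graph n) → Connected H → ∀ u → I G v ≗ I H u → RootedIso G v H u)

Decisive : (G : Graph n) → Fin n → Set₁
Decisive G v = Decisive[ W ] G v × Decisive[ R ] G v

{-# OPTIONS --safe #-}
module Submission where

-- Over ℚ, let A be the adjacency matrix of G.  By Cayley–Hamilton and irreducibility,
-- the annihilator of any nonzero vector x under p ↦ p(A) x is generated by P_G, which
-- has degree n, so x, A x, …, A^(n-1) x is a basis; hence only 0 is orthogonal to all
-- A^k x, and e_u ∈ ℚ[A] e_v gives connectedness.
--
-- The numbers of walks are the entries (A^k 1)_v and (A^k e_v)_v.  If they agree with
-- those of u in H, then P_H(A) x is orthogonal to all A^k e_v, where x = 1 or x = e_v;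
-- so P_H(A) x = 0, P_G divides P_H, the two are equal, and G ≅ H.  It remains to
-- separate the vertices of G itself.  For W, e_v − e_u is orthogonal to all A^k 1.
-- For R, e_u is plus or minus e_v, see moments-separate.

-- The field ℚ[A] enters only in this form: a polynomial in A that kills one nonzero vector is a
-- multiple of P_G. Inverses in it are never formed, and scalars are cleared rather than divided
-- out, which is why a e_u = p e_v carries a factor a. Most of the work is Cayley-Hamilton for a
-- determinant that is given as a Laplace expansion. When z acts as A, the rows of z I - A kill the
-- tuple (e_1, ..., e_n), and a determinant kills every member of a tuple that all its rows kill.
-- This rests on alternation in the columns, so minors are indexed by lists of columns, where
-- neighbours can be exchanged. The case R is harder than W because its numbers ⟨e_v, A^k e_v⟩ are
-- quadratic in e_v: they determine e_v only up to sign, and the sign is then excluded by comparing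
-- entries at v.

open import Defs
open import Algebra.Bundles using (CommutativeRing)
open import Algebra.Bundles.Raw using (RawRing)
open import Algebra.Definitions.RawMagma (RawRing.*-rawMagma ℚ[z]) using (module _∣ʳ_)
open import Algebra.Definitions.RawSemiring (RawRing.rawSemiring ℚ[z]) using (module Irreducible)
import Algebra.Definitions.RawSemiring
import Algebra.Properties.Ring
import Algebra.Properties.Semiring.Sum
open import Data.Bool using (true; false; if_then_else_)
open import Data.Fin using (Fin; zero; suc; toℕ; _≟_; punchIn)
open import Data.Fin.Permutation using (Permutation; _⟨$⟩ʳ_; _⟨$⟩ˡ_; inverseˡ; inverseʳ)
open import Data.Fin.Properties using (any?; punchInᵢ≢i; suc-injective)
open import Data.List as List using (List; []; _∷_; _++_; _ʳ++_; allFin; cartesianProductWith; filter; length)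
open import Data.List.Membership.Propositional using (_∈_)
open import Data.List.Membership.Propositional.Properties using (∈-∃++; ∈-++⁻; ∈-++⁺ˡ; ∈-++⁺ʳ; ∈-allFin; ∈-tabulate⁻)
open import Data.List.Properties using (++-ʳ++; ʳ++-ʳ++; ʳ++-defn; reverse-involutive)
open import Data.List.Relation.Unary.Any using (here; there)
open import Data.Nat as ℕ using (ℕ; zero; suc; z≤n; s≤s)
import Data.Nat.Properties as ℕ
open import Data.Product using (∃; ∃₂; _×_; _,_; map)
open import Data.Rational hiding (_≃_; _≟_)
open import Data.Rational.Properties as ℚ hiding (≃-sym; _≟_)
open import Data.Rational.Solver using (module +-*-Solver)
open import Data.Sum using (_⊎_; inj₁; inj₂)
open import Data.Vec as Vec using (Vec; []; _∷_)
open import Data.Vec.Functional using (Vector; removeAt; insertAt)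
open import Data.Vec.Functional.Properties using (insertAt-lookup; insertAt-punchIn)
open import Data.Vec.Relation.Unary.Linked using (linked?)
open import Function using (_∘_; Equivalence)
open import Level using (0ℓ)
open import Relation.Binary.Construct.Closure.ReflexiveTransitive using (Star; ε; _◅_)
open import Relation.Binary.PropositionalEquality
import Relation.Binary.Reasoning.Setoid
open import Relation.Nullary using (¬_; Dec; does; yes; no; contradiction)
open import Relation.Nullary.Decidable using (¬?; _×-dec_; decidable-stable)
open import Relation.Unary using (Pred; Decidable)

open +-*-Solver using (solve; con; _:=_; _:+_; _:*_; :-_; _:-_)
open _∣ʳ_ using (quotient; equality)

-- The commutative ring ℚ[z]

-- Unlike _≈ₚ_, which unfolds to a function type, this record lets its two
-- sides be inferred by unification.
infix 4 _≃_
record _≃_ (p q : Poly) : Set where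
  constructor mk≃
  field at : p ≈ₚ q
open _≃_ public

≃-refl : ∀ {p} → p ≃ p
≃-refl = mk≃ λ _ → refl

≃-sym : ∀ {p q} → p ≃ q → q ≃ p
≃-sym e = mk≃ (sym ∘ at e)

≃-trans : ∀ {p q r} → p ≃ q → q ≃ r → p ≃ r
≃-trans e f = mk≃ λ k → trans (at e k) (at f k)

coeff-+ : ∀ p q k → coeff (p +ₚ q) k ≡ coeff p k + coeff q k
coeff-+ []      q       k       = sym (+-identityˡ _)
coeff-+ (a ∷ p) []      k       = sym (+-identityʳ _)
coeff-+ (a ∷ p) (b ∷ q) zero    = refl
coeff-+ (a ∷ p) (b ∷ q) (suc k) = coeff-+ p q k

coeff-neg : ∀ p k → coeff (-ₚ p) k ≡ - coeff p k
coeff-neg []      k       = refl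
coeff-neg (a ∷ p) zero    = refl
coeff-neg (a ∷ p) (suc k) = coeff-neg p k

coeff-scale : ∀ a p k → coeff (List.map (a *_) p) k ≡ a * coeff p k
coeff-scale a []      k       = sym (*-zeroʳ a)
coeff-scale a (b ∷ p) zero    = refl
coeff-scale a (b ∷ p) (suc k) = coeff-scale a p k

coeff-*-zero : ∀ a p q → coeff ((a ∷ p) *ₚ q) 0 ≡ a * coeff q 0
coeff-*-zero a p q =
  trans (coeff-+ (List.map (a *_) q) _ 0)
        (trans (+-identityʳ _) (coeff-scale a q 0))

coeff-*-suc : ∀ a p q k →
  coeff ((a ∷ p) *ₚ q) (suc k) ≡ a * coeff q (suc k) + coeff (p *ₚ q) k
coeff-*-suc a p q k =
  trans (coeff-+ (List.map (a *_) q) _ (suc k))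
        (cong (_+ coeff (p *ₚ q) k) (coeff-scale a q (suc k)))

≃-tail : ∀ {a b p q} → a ∷ p ≃ b ∷ q → p ≃ q
≃-tail e = mk≃ (at e ∘ suc)

≃[]-tail : ∀ {a p} → a ∷ p ≃ [] → p ≃ []
≃[]-tail e = mk≃ (at e ∘ suc)

+ₚ-cong : ∀ {p p′ q q′} → p ≃ p′ → q ≃ q′ → p +ₚ q ≃ p′ +ₚ q′
+ₚ-cong {p} {p′} {q} {q′} e f = mk≃ λ k →
  trans (coeff-+ p q k) (trans (cong₂ _+_ (at e k) (at f k)) (sym (coeff-+ p′ q′ k)))

+ₚ-assoc : ∀ p q r → (p +ₚ q) +ₚ r ≃ p +ₚ (q +ₚ r)
+ₚ-assoc p q r = mk≃ λ k → begin
  coeff ((p +ₚ q) +ₚ r) k              ≡⟨ coeff-+ (p +ₚ q) r k ⟩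
  coeff (p +ₚ q) k + coeff r k         ≡⟨ cong (_+ coeff r k) (coeff-+ p q k) ⟩
  coeff p k + coeff q k + coeff r k    ≡⟨ +-assoc (coeff p k) (coeff q k) (coeff r k) ⟩
  coeff p k + (coeff q k + coeff r k)  ≡⟨ cong (coeff p k +_) (coeff-+ q r k) ⟨
  coeff p k + coeff (q +ₚ r) k         ≡⟨ coeff-+ p (q +ₚ r) k ⟨
  coeff (p +ₚ (q +ₚ r)) k              ∎
  where open ≡-Reasoning

+ₚ-comm : ∀ p q → p +ₚ q ≃ q +ₚ p
+ₚ-comm p q = mk≃ λ k →
  trans (coeff-+ p q k) (trans (+-comm (coeff p k) (coeff q k)) (sym (coeff-+ q p k)))

-ₚ-cong : ∀ {p q} → p ≃ q → -ₚ p ≃ -ₚ q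
-ₚ-cong {p} {q} e = mk≃ λ k →
  trans (coeff-neg p k) (trans (cong -_ (at e k)) (sym (coeff-neg q k)))

-ₚ-inverseˡ : ∀ p → -ₚ p +ₚ p ≃ []
-ₚ-inverseˡ p = mk≃ λ k →
  trans (coeff-+ (-ₚ p) p k)
        (trans (cong (_+ coeff p k) (coeff-neg p k)) (+-inverseˡ (coeff p k)))

*ₚ-congˡ : ∀ p {q q′} → q ≃ q′ → p *ₚ q ≃ p *ₚ q′
*ₚ-congˡ []      e = ≃-refl
*ₚ-congˡ (a ∷ p) {q} {q′} e = mk≃ λ where
  zero    → trans (coeff-*-zero a p q)
                  (trans (cong (a *_) (at e 0)) (sym (coeff-*-zero a p q′)))
  (suc k) → trans (coeff-*-suc a p q k)
                  (trans (cong₂ (λ b c → a * b + c) (at e (suc k)) (at (*ₚ-congˡ p e) k))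
                         (sym (coeff-*-suc a p q′ k)))

-- A polynomial equal to zero may still list any number of zero coefficients, so congruence in the
-- left factor has to treat this case apart.
*ₚ-annihilˡ : ∀ p q → p ≃ [] → p *ₚ q ≃ []
*ₚ-annihilˡ []      q e = ≃-refl
*ₚ-annihilˡ (a ∷ p) q e = mk≃ λ where
  zero    → trans (coeff-*-zero a p q)
                  (trans (cong (_* coeff q 0) (at e 0)) (*-zeroˡ (coeff q 0)))
  (suc k) → trans (coeff-*-suc a p q k)
                  (trans (cong₂ (λ b c → b * coeff q (suc k) + c) (at e 0)
                                (at (*ₚ-annihilˡ p q (≃[]-tail e)) k))
                         (trans (+-identityʳ _) (*-zeroˡ (coeff q (suc k)))))

*ₚ-congʳ : ∀ {p p′} q → p ≃ p′ → p *ₚ q ≃ p′ *ₚ q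
*ₚ-congʳ {[]}    {p′}     q e = ≃-sym (*ₚ-annihilˡ p′ q (≃-sym e))
*ₚ-congʳ {a ∷ p} {[]}     q e = *ₚ-annihilˡ (a ∷ p) q e
*ₚ-congʳ {a ∷ p} {b ∷ p′} q e = mk≃ λ where
  zero    → trans (coeff-*-zero a p q)
                  (trans (cong (_* coeff q 0) (at e 0)) (sym (coeff-*-zero b p′ q)))
  (suc k) → trans (coeff-*-suc a p q k)
                  (trans (cong₂ (λ b c → b * coeff q (suc k) + c) (at e 0)
                                (at (*ₚ-congʳ {p} {p′} q (≃-tail e)) k))
                         (sym (coeff-*-suc b p′ q k)))

*ₚ-distribʳ : ∀ r p q → (p +ₚ q) *ₚ r ≃ p *ₚ r +ₚ q *ₚ r
*ₚ-distribʳ r []      q       = ≃-refl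
*ₚ-distribʳ r (a ∷ p) []      = mk≃ λ k →
  sym (trans (coeff-+ ((a ∷ p) *ₚ r) [] k) (+-identityʳ _))
*ₚ-distribʳ r (a ∷ p) (b ∷ q) = mk≃ λ k →
  trans (lemma k) (sym (coeff-+ ((a ∷ p) *ₚ r) ((b ∷ q) *ₚ r) k))
  where
  open ≡-Reasoning
  lemma : ∀ k → coeff (((a + b) ∷ p +ₚ q) *ₚ r) k
              ≡ coeff ((a ∷ p) *ₚ r) k + coeff ((b ∷ q) *ₚ r) k
  lemma zero    = begin
    coeff (((a + b) ∷ p +ₚ q) *ₚ r) 0  ≡⟨ coeff-*-zero (a + b) (p +ₚ q) r ⟩
    (a + b) * coeff r 0                ≡⟨ *-distribʳ-+ (coeff r 0) a b ⟩
    a * coeff r 0 + b * coeff r 0      ≡⟨ cong₂ _+_ (coeff-*-zero a p r) (coeff-*-zero b q r) ⟨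
    coeff ((a ∷ p) *ₚ r) 0 + coeff ((b ∷ q) *ₚ r) 0 ∎
  lemma (suc k) = begin
    coeff (((a + b) ∷ p +ₚ q) *ₚ r) (suc k)
      ≡⟨ coeff-*-suc (a + b) (p +ₚ q) r k ⟩
    (a + b) * coeff r (suc k) + coeff ((p +ₚ q) *ₚ r) k
      ≡⟨ cong ((a + b) * coeff r (suc k) +_)
              (trans (at (*ₚ-distribʳ r p q) k) (coeff-+ (p *ₚ r) (q *ₚ r) k)) ⟩
    (a + b) * coeff r (suc k) + (coeff (p *ₚ r) k + coeff (q *ₚ r) k)
      ≡⟨ solve 5 (λ a b c x y → (a :+ b) :* c :+ (x :+ y) := (a :* c :+ x) :+ (b :* c :+ y))
               refl a b (coeff r (suc k)) (coeff (p *ₚ r) k) (coeff (q *ₚ r) k) ⟩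
    (a * coeff r (suc k) + coeff (p *ₚ r) k) + (b * coeff r (suc k) + coeff (q *ₚ r) k)
      ≡⟨ cong₂ _+_ (coeff-*-suc a p r k) (coeff-*-suc b q r k) ⟨
    coeff ((a ∷ p) *ₚ r) (suc k) + coeff ((b ∷ q) *ₚ r) (suc k) ∎

*ₚ-zeroʳ : ∀ p → p *ₚ [] ≃ []
*ₚ-zeroʳ []      = ≃-refl
*ₚ-zeroʳ (a ∷ p) = mk≃ λ where
  zero    → refl
  (suc k) → at (*ₚ-zeroʳ p) k

-- The mirror image of the defining recursion, which runs on the left factor; commutativity is the
-- comparison of the two.
*ₚ-∷ʳ : ∀ p b q → p *ₚ (b ∷ q) ≃ List.map (b *_) p +ₚ (0ℚ ∷ p *ₚ q)
*ₚ-∷ʳ []      b q = mk≃ λ where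
  zero    → refl
  (suc k) → refl
*ₚ-∷ʳ (a ∷ p) b q = mk≃ λ where
    zero    → cong (_+ 0ℚ) (*-comm a b)
    (suc k) → begin
      coeff (List.map (a *_) q +ₚ p *ₚ (b ∷ q)) k
        ≡⟨ trans (coeff-+ (List.map (a *_) q) _ k) (cong (coeff (List.map (a *_) q) k +_)
             (trans (at (*ₚ-∷ʳ p b q) k) (coeff-+ (List.map (b *_) p) _ k))) ⟩
      coeff (List.map (a *_) q) k + (coeff (List.map (b *_) p) k + coeff (0ℚ ∷ p *ₚ q) k)
        ≡⟨ solve 3 (λ x y z → x :+ (y :+ z) := y :+ (x :+ z)) refl
                 (coeff (List.map (a *_) q) k) (coeff (List.map (b *_) p) k) (coeff (0ℚ ∷ p *ₚ q) k) ⟩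
      coeff (List.map (b *_) p) k + (coeff (List.map (a *_) q) k + coeff (0ℚ ∷ p *ₚ q) k)
        ≡⟨ trans (coeff-+ (List.map (b *_) p) _ k) (cong (coeff (List.map (b *_) p) k +_)
             (coeff-+ (List.map (a *_) q) _ k)) ⟨
      coeff (List.map (b *_) p +ₚ (a ∷ p) *ₚ q) k ∎
  where open ≡-Reasoning

∷-cong : ∀ {a p q} → p ≃ q → a ∷ p ≃ a ∷ q
∷-cong e = mk≃ λ where
  zero    → refl
  (suc k) → at e k

*ₚ-comm : ∀ p q → p *ₚ q ≃ q *ₚ p
*ₚ-comm []      q = ≃-sym (*ₚ-zeroʳ q)
*ₚ-comm (a ∷ p) q =
  ≃-trans (+ₚ-cong {List.map (a *_) q} ≃-refl (∷-cong (*ₚ-comm p q)))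
          (≃-sym (*ₚ-∷ʳ q a p))

scale-*ₚ : ∀ a q r → List.map (a *_) q *ₚ r ≃ List.map (a *_) (q *ₚ r)
scale-*ₚ a []      r = ≃-refl
scale-*ₚ a (b ∷ q) r = mk≃ λ where
    zero    → begin
      coeff ((a * b ∷ List.map (a *_) q) *ₚ r) 0  ≡⟨ coeff-*-zero (a * b) (List.map (a *_) q) r ⟩
      a * b * coeff r 0                           ≡⟨ *-assoc a b _ ⟩
      a * (b * coeff r 0)                         ≡⟨ cong (a *_) (coeff-*-zero b q r) ⟨
      a * coeff ((b ∷ q) *ₚ r) 0                  ≡⟨ coeff-scale a ((b ∷ q) *ₚ r) 0 ⟨
      coeff (List.map (a *_) ((b ∷ q) *ₚ r)) 0    ∎
    (suc k) → begin
      coeff ((a * b ∷ List.map (a *_) q) *ₚ r) (suc k)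
        ≡⟨ coeff-*-suc (a * b) (List.map (a *_) q) r k ⟩
      a * b * coeff r (suc k) + coeff (List.map (a *_) q *ₚ r) k
        ≡⟨ cong (a * b * coeff r (suc k) +_)
                (trans (at (scale-*ₚ a q r) k) (coeff-scale a (q *ₚ r) k)) ⟩
      a * b * coeff r (suc k) + a * coeff (q *ₚ r) k
        ≡⟨ solve 4 (λ a b x y → a :* b :* x :+ a :* y := a :* (b :* x :+ y)) refl
                 a b (coeff r (suc k)) (coeff (q *ₚ r) k) ⟩
      a * (b * coeff r (suc k) + coeff (q *ₚ r) k)
        ≡⟨ cong (a *_) (coeff-*-suc b q r k) ⟨
      a * coeff ((b ∷ q) *ₚ r) (suc k)
        ≡⟨ coeff-scale a ((b ∷ q) *ₚ r) (suc k) ⟨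
      coeff (List.map (a *_) ((b ∷ q) *ₚ r)) (suc k) ∎
  where open ≡-Reasoning

shift-*ₚ : ∀ p q → (0ℚ ∷ p) *ₚ q ≃ 0ℚ ∷ p *ₚ q
shift-*ₚ p q = mk≃ λ where
  zero    → trans (coeff-*-zero 0ℚ p q) (*-zeroˡ (coeff q 0))
  (suc k) → trans (coeff-*-suc 0ℚ p q k)
                  (trans (cong (_+ coeff (p *ₚ q) k) (*-zeroˡ (coeff q (suc k))))
                         (+-identityˡ _))

*ₚ-assoc : ∀ p q r → (p *ₚ q) *ₚ r ≃ p *ₚ (q *ₚ r)
*ₚ-assoc []      q r = ≃-refl
*ₚ-assoc (a ∷ p) q r =
  ≃-trans (*ₚ-distribʳ r (List.map (a *_) q) (0ℚ ∷ p *ₚ q))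
          (+ₚ-cong (scale-*ₚ a q r)
                   (≃-trans (shift-*ₚ (p *ₚ q) r) (∷-cong (*ₚ-assoc p q r))))

*ₚ-identityˡ : ∀ q → const 1ℚ *ₚ q ≃ q
*ₚ-identityˡ q = mk≃ λ where
  zero    → trans (coeff-*-zero 1ℚ [] q) (*-identityˡ _)
  (suc k) → trans (coeff-*-suc 1ℚ [] q k)
                  (trans (+-identityʳ _) (*-identityˡ _))

polyRing : CommutativeRing 0ℓ 0ℓ
polyRing = record
  { Carrier = Poly
  ; _≈_ = _≃_
  ; _+_ = _+ₚ_
  ; _*_ = _*ₚ_
  ; -_  = -ₚ_
  ; 0#  = []
  ; 1#  = const 1ℚ
  ; isCommutativeRing = record
    { isRing = record
      { +-isAbelianGroup = record
        { isGroup = record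
          { isMonoid = record
            { isSemigroup = record
              { isMagma = record
                { isEquivalence = record { refl = ≃-refl ; sym = ≃-sym ; trans = ≃-trans }
                ; ∙-cong = +ₚ-cong
                }
              ; assoc = +ₚ-assoc
              }
            ; identity = (λ _ → ≃-refl) , λ p → +ₚ-comm p []
            }
          ; inverse = -ₚ-inverseˡ , λ p → ≃-trans (+ₚ-comm p (-ₚ p)) (-ₚ-inverseˡ p)
          ; ⁻¹-cong = -ₚ-cong
          }
        ; comm = +ₚ-comm
        }
      ; *-cong = λ {p} {p′} {q} {q′} e f → ≃-trans (*ₚ-congʳ q e) (*ₚ-congˡ p′ f)
      ; *-assoc = *ₚ-assoc
      ; *-identity = *ₚ-identityˡ , λ p → ≃-trans (*ₚ-comm p (const 1ℚ)) (*ₚ-identityˡ p)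
      ; distrib = (λ p q r → ≃-trans (*ₚ-comm p (q +ₚ r)) (≃-trans (*ₚ-distribʳ p q r)
                    (+ₚ-cong (*ₚ-comm q p) (*ₚ-comm r p))))
                , *ₚ-distribʳ
      }
    ; *-comm = *ₚ-comm
    }
  }

-- Vectors over ℚ and the action of ℚ[z] through a matrix

private
  module ℚSum = Algebra.Properties.Semiring.Sum (CommutativeRing.semiring +-*-commutativeRing)

-- Opaque, so that the summand can be inferred by unification.
opaque
  ∑ : ∀ {n} → Vector ℚ n → ℚ
  ∑ = ℚSum.sum

  ∑-empty : (t : Vector ℚ 0) → ∑ t ≡ 0ℚ
  ∑-empty t = refl

  ∑-suc : ∀ {n} (t : Vector ℚ (suc n)) → ∑ t ≡ t zero + ∑ (t ∘ suc)
  ∑-suc t = refl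

  ∑-cong : ∀ {n} {s t : Vector ℚ n} → s ≗ t → ∑ s ≡ ∑ t
  ∑-cong = ℚSum.sum-cong-≗

  ∑-remove : ∀ {n} i (t : Vector ℚ (suc n)) → ∑ t ≡ t i + ∑ (removeAt t i)
  ∑-remove i t = ℚSum.sum-remove t

  ∑-+ : ∀ {n} (s t : Vector ℚ n) → ∑ (λ i → s i + t i) ≡ ∑ s + ∑ t
  ∑-+ = ℚSum.∑-distrib-+

  ∑-comm : ∀ {m n} (t : Fin m → Fin n → ℚ) →
           ∑ (λ i → ∑ λ j → t i j) ≡ ∑ (λ j → ∑ λ i → t i j)
  ∑-comm = ℚSum.∑-comm

  ∑-permute : ∀ {m n} (t : Vector ℚ n) (π : Permutation m n) → ∑ t ≡ ∑ (t ∘ (π ⟨$⟩ʳ_))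
  ∑-permute = ℚSum.sum-permute

  *-distribˡ-∑ : ∀ {n} a (t : Vector ℚ n) → a * ∑ t ≡ ∑ (λ i → a * t i)
  *-distribˡ-∑ = ℚSum.*-distribˡ-sum

  *-distribʳ-∑ : ∀ {n} a (t : Vector ℚ n) → ∑ t * a ≡ ∑ (λ i → t i * a)
  *-distribʳ-∑ = ℚSum.*-distribʳ-sum

  ∑-zero : ∀ {n} (t : Vector ℚ n) → (∀ i → t i ≡ 0ℚ) → ∑ t ≡ 0ℚ
  ∑-zero {n} t t≗0 = trans (∑-cong t≗0) (ℚSum.sum-replicate-zero n)

∑-single : ∀ {n} k (t : Vector ℚ n) → (∀ i → i ≢ k → t i ≡ 0ℚ) → ∑ t ≡ t k
∑-single {suc n} k t t≗0 =
  trans (∑-remove k t)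
        (trans (cong (t k +_) (∑-zero (removeAt t k) λ i → t≗0 _ (punchInᵢ≢i k i)))
               (+-identityʳ _))

basis : ∀ {n} → Fin n → Vector ℚ n
basis = identity

basis-same : ∀ {n} (i : Fin n) → basis i i ≡ 1ℚ
basis-same i with i ≟ i
... | yes _   = refl
... | no i≢i = contradiction refl i≢i

basis-other : ∀ {n} {i j : Fin n} → i ≢ j → basis i j ≡ 0ℚ
basis-other {i = i} {j} i≢j with i ≟ j
... | yes i≡j = contradiction i≡j i≢j
... | no _    = refl

∑-basisˡ : ∀ {n} k (x : Vector ℚ n) → ∑ (λ i → basis k i * x i) ≡ x k
∑-basisˡ k x =
  trans (∑-single k _ λ i i≢k →
          trans (cong (_* x i) (basis-other (i≢k ∘ sym))) (*-zeroˡ (x i)))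
        (trans (cong (_* x k) (basis-same k)) (*-identityˡ (x k)))

infix 8 ⟨_,_⟩
⟨_,_⟩ : ∀ {n} → Vector ℚ n → Vector ℚ n → ℚ
⟨ x , y ⟩ = ∑ λ i → x i * y i

⟨⟩-cong : ∀ {n} {x x′ y y′ : Vector ℚ n} → x ≗ x′ → y ≗ y′ → ⟨ x , y ⟩ ≡ ⟨ x′ , y′ ⟩
⟨⟩-cong e f = ∑-cong λ i → cong₂ _*_ (e i) (f i)

⟨⟩-comm : ∀ {n} (x y : Vector ℚ n) → ⟨ x , y ⟩ ≡ ⟨ y , x ⟩
⟨⟩-comm x y = ∑-cong λ i → *-comm (x i) (y i)

record Linear {m n} (T : Vector ℚ m → Vector ℚ n) : Set where
  field
    T-cong : ∀ {x y} → x ≗ y → T x ≗ T y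
    T-+    : ∀ x y → T (λ i → x i + y i) ≗ λ i → T x i + T y i
    T-*    : ∀ a x → T (λ i → a * x i) ≗ λ i → a * T x i

  T-0 : ∀ {x} → (∀ i → x i ≡ 0ℚ) → ∀ i → T x i ≡ 0ℚ
  T-0 {x} x≗0 i =
    trans (T-cong (λ j → trans (x≗0 j) (sym (*-zeroˡ (x j)))) i)
          (trans (T-* 0ℚ x i) (*-zeroˡ (T x i)))

  T-∑ : ∀ {k} (X : Vector (Vector ℚ m) k) →
          T (λ i → ∑ λ j → X j i) ≗ λ i → ∑ λ j → T (X j) i
  T-∑ {zero}  X i = trans (T-0 (λ j → ∑-empty _) i) (sym (∑-empty _))
  T-∑ {suc k} X i =
    trans (T-cong (λ j → ∑-suc _) i)
          (trans (T-+ (X zero) _ i)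
                 (trans (cong (T (X zero) i +_) (T-∑ (X ∘ suc) i)) (sym (∑-suc _))))

  T-comb : ∀ {k} (c : Vector ℚ k) (X : Vector (Vector ℚ m) k) →
           T (λ i → ∑ λ j → c j * X j i) ≗ λ i → ∑ λ j → c j * T (X j) i
  T-comb c X i = trans (T-∑ _ i) (∑-cong λ j → T-* (c j) (X j) i)

infixr 8 _·_
_·_ : ∀ {n} → Matrix ℚ n → Vector ℚ n → Vector ℚ n
(A · x) i = ⟨ A i , x ⟩

·-linear : ∀ {n} (A : Matrix ℚ n) → Linear (A ·_)
·-linear A = record
  { T-cong = λ e i → ⟨⟩-cong {x = A i} (λ _ → refl) e
  ; T-+    = λ x y i → trans (∑-cong λ j → *-distribˡ-+ (A i j) (x j) (y j))
                             (∑-+ _ _)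
  ; T-*    = λ a x i → trans (∑-cong λ j → solve 3 (λ A a x → A :* (a :* x) := a :* (A :* x))
                                                   refl (A i j) a (x j))
                             (sym (*-distribˡ-∑ a _))
  }

Symmetricᴹ : ∀ {n} → Matrix ℚ n → Set
Symmetricᴹ A = ∀ i j → A i j ≡ A j i

·-selfAdjoint : ∀ {n} (A : Matrix ℚ n) → Symmetricᴹ A →
                ∀ x y → ⟨ A · x , y ⟩ ≡ ⟨ x , A · y ⟩
·-selfAdjoint A A-sym x y = begin
  ∑ (λ i → ∑ (λ j → A i j * x j) * y i)    ≡⟨ ∑-cong (λ i → *-distribʳ-∑ (y i) _) ⟩
  ∑ (λ i → ∑ (λ j → A i j * x j * y i))    ≡⟨ ∑-comm _ ⟩
  ∑ (λ j → ∑ (λ i → A i j * x j * y i))    ≡⟨ ∑-cong (λ j → ∑-cong λ i →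
      trans (cong (λ a → a * x j * y i) (A-sym i j))
            (solve 3 (λ a x y → a :* x :* y := x :* (a :* y)) refl (A j i) (x j) (y i))) ⟩
  ∑ (λ j → ∑ (λ i → x j * (A j i * y i)))  ≡⟨ ∑-cong (λ j → *-distribˡ-∑ (x j) _) ⟨
  ∑ (λ j → x j * ∑ (λ i → A j i * y i))    ∎
  where open ≡-Reasoning

module Action {n} (A : Matrix ℚ n) where

  open Linear (·-linear A) renaming
    (T-cong to ·-cong; T-+ to ·-+; T-* to ·-*; T-0 to ·-0)

  infixr 8 _⋆_
  -- This is p(A) x, evaluated by Horner's scheme.
  _⋆_ : Poly → Vector ℚ n → Vector ℚ n
  ([]      ⋆ x) i = 0ℚ
  ((a ∷ p) ⋆ x) i = a * x i + (A · (p ⋆ x)) i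

  ⋆-linear : ∀ p → Linear (p ⋆_)
  ⋆-linear []      = record
    { T-cong = λ _ _ → refl
    ; T-+    = λ _ _ _ → refl
    ; T-*    = λ a _ _ → sym (*-zeroʳ a)
    }
  ⋆-linear (a ∷ p) = record
    { T-cong = λ e i → cong₂ (λ b c → a * b + c) (e i) (·-cong (T-cong e) i)
    ; T-+    = λ x y i →
        trans (cong (a * (x i + y i) +_) (trans (·-cong (T-+ x y) i) (·-+ (p ⋆ x) (p ⋆ y) i)))
              (solve 5 (λ a x y u v → a :* (x :+ y) :+ (u :+ v) := a :* x :+ u :+ (a :* y :+ v))
                     refl a (x i) (y i) ((A · (p ⋆ x)) i) ((A · (p ⋆ y)) i))
    ; T-*    = λ b x i →
        trans (cong (a * (b * x i) +_) (trans (·-cong (T-* b x) i) (·-* b (p ⋆ x) i)))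
              (solve 4 (λ a b x u → a :* (b :* x) :+ b :* u := b :* (a :* x :+ u))
                     refl a b (x i) ((A · (p ⋆ x)) i))
    }
    where open Linear (⋆-linear p)

  module _ (p : Poly) where
    open Linear (⋆-linear p) public using ()
      renaming (T-cong to ⋆-congʳ; T-+ to ⋆-+ʳ; T-* to ⋆-*ʳ; T-0 to ⋆-0; T-∑ to ⋆-∑)

  ⋆-annihil : ∀ p x → p ≃ [] → ∀ i → (p ⋆ x) i ≡ 0ℚ
  ⋆-annihil []      x e i = refl
  ⋆-annihil (a ∷ p) x e i =
    trans (cong₂ (λ b c → b * x i + c) (at e 0) (·-0 (⋆-annihil p x (≃[]-tail e)) i))
          (trans (+-identityʳ _) (*-zeroˡ (x i)))

  ⋆-congˡ : ∀ {p q} x → p ≃ q → p ⋆ x ≗ q ⋆ x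
  ⋆-congˡ {[]}    {q}     x e i = sym (⋆-annihil q x (≃-sym e) i)
  ⋆-congˡ {a ∷ p} {[]}    x e i = ⋆-annihil (a ∷ p) x e i
  ⋆-congˡ {a ∷ p} {b ∷ q} x e i =
    cong₂ (λ c d → c * x i + d) (at e 0) (·-cong (⋆-congˡ {p} {q} x (≃-tail e)) i)

  ⋆-+ˡ : ∀ p q x → (p +ₚ q) ⋆ x ≗ λ i → (p ⋆ x) i + (q ⋆ x) i
  ⋆-+ˡ []      q       x i = sym (+-identityˡ _)
  ⋆-+ˡ (a ∷ p) []      x i = sym (+-identityʳ _)
  ⋆-+ˡ (a ∷ p) (b ∷ q) x i =
    trans (cong ((a + b) * x i +_)
                (trans (·-cong (⋆-+ˡ p q x) i) (·-+ (p ⋆ x) (q ⋆ x) i)))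
          (solve 5 (λ a b x u v → (a :+ b) :* x :+ (u :+ v) := a :* x :+ u :+ (b :* x :+ v))
                 refl a b (x i) ((A · (p ⋆ x)) i) ((A · (q ⋆ x)) i))

  ⋆-scaleˡ : ∀ a p x → List.map (a *_) p ⋆ x ≗ λ i → a * (p ⋆ x) i
  ⋆-scaleˡ a []      x i = sym (*-zeroʳ a)
  ⋆-scaleˡ a (b ∷ p) x i =
    trans (cong (a * b * x i +_)
                (trans (·-cong (⋆-scaleˡ a p x) i) (·-* a (p ⋆ x) i)))
          (solve 4 (λ a b x u → a :* b :* x :+ a :* u := a :* (b :* x :+ u))
                 refl a b (x i) ((A · (p ⋆ x)) i))

  ⋆-shift : ∀ p x → (0ℚ ∷ p) ⋆ x ≗ A · (p ⋆ x)
  ⋆-shift p x i = trans (cong (_+ (A · (p ⋆ x)) i) (*-zeroˡ (x i))) (+-identityˡ _)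

  ⋆-neg : ∀ p x → (-ₚ p) ⋆ x ≗ λ i → - (p ⋆ x) i
  ⋆-neg p x i = begin
    ((-ₚ p) ⋆ x) i                                  ≡⟨ solve 2 (λ u v → v := :- u :+ (v :+ u)) refl ((p ⋆ x) i) _ ⟩
    - (p ⋆ x) i + (((-ₚ p) ⋆ x) i + (p ⋆ x) i)      ≡⟨ cong (- (p ⋆ x) i +_) (⋆-+ˡ (-ₚ p) p x i) ⟨
    - (p ⋆ x) i + ((-ₚ p +ₚ p) ⋆ x) i               ≡⟨ cong (- (p ⋆ x) i +_) (⋆-annihil _ x (-ₚ-inverseˡ p) i) ⟩
    - (p ⋆ x) i + 0ℚ                                ≡⟨ +-identityʳ _ ⟩
    - (p ⋆ x) i                                     ∎
    where open ≡-Reasoning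

  ⋆-assoc : ∀ p q x → (p *ₚ q) ⋆ x ≗ p ⋆ (q ⋆ x)
  ⋆-assoc []      q x i = refl
  ⋆-assoc (a ∷ p) q x i =
    trans (⋆-+ˡ (List.map (a *_) q) _ x i)
          (cong₂ _+_ (⋆-scaleˡ a q x i)
                     (trans (⋆-shift (p *ₚ q) x i) (·-cong (⋆-assoc p q x) i)))

  ⋆-const : ∀ a x → const a ⋆ x ≗ λ i → a * x i
  ⋆-const a x i = trans (cong (a * x i +_) (·-0 (λ _ → refl) i)) (+-identityʳ _)

  ⋆-𝐳 : ∀ x → 𝐳 ⋆ x ≗ A · x
  ⋆-𝐳 x i = trans (⋆-shift (const 1ℚ) x i)
                  (·-cong (λ j → trans (⋆-const 1ℚ x j) (*-identityˡ (x j))) i)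

  ⋆-comm : ∀ p q x → p ⋆ (q ⋆ x) ≗ q ⋆ (p ⋆ x)
  ⋆-comm p q x i =
    trans (sym (⋆-assoc p q x i)) (trans (⋆-congˡ x (*ₚ-comm p q) i) (⋆-assoc q p x i))

  ⋆-· : ∀ p x → p ⋆ (A · x) ≗ A · (p ⋆ x)
  ⋆-· p x i = begin
    (p ⋆ (A · x)) i  ≡⟨ ⋆-congʳ p (⋆-𝐳 x) i ⟨
    (p ⋆ (𝐳 ⋆ x)) i  ≡⟨ ⋆-comm p 𝐳 x i ⟩
    (𝐳 ⋆ (p ⋆ x)) i  ≡⟨ ⋆-𝐳 (p ⋆ x) i ⟩
    (A · (p ⋆ x)) i  ∎
    where open ≡-Reasoning

  ⋆-selfAdjoint : Symmetricᴹ A → ∀ p x y → ⟨ p ⋆ x , y ⟩ ≡ ⟨ x , p ⋆ y ⟩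
  ⋆-selfAdjoint A-sym []      x y =
    trans (∑-zero _ λ i → *-zeroˡ (y i)) (sym (∑-zero _ λ i → *-zeroʳ (x i)))
  ⋆-selfAdjoint A-sym (a ∷ p) x y = begin
    ⟨ (a ∷ p) ⋆ x , y ⟩
      ≡⟨ trans (∑-cong λ i → *-distribʳ-+ (y i) (a * x i) _) (∑-+ _ _) ⟩
    ∑ (λ i → a * x i * y i) + ⟨ A · (p ⋆ x) , y ⟩
      ≡⟨ cong₂ _+_ (∑-cong λ i → solve 3 (λ a x y → a :* x :* y := x :* (a :* y)) refl a (x i) (y i))
                   (trans (·-selfAdjoint A A-sym (p ⋆ x) y)
                          (trans (⋆-selfAdjoint A-sym p x (A · y)) (⟨⟩-cong {x = x} (λ _ → refl) (⋆-· p y)))) ⟩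
    ∑ (λ i → x i * (a * y i)) + ⟨ x , A · (p ⋆ y) ⟩
      ≡⟨ trans (∑-cong λ i → *-distribˡ-+ (x i) (a * y i) _) (∑-+ _ _) ⟨
    ⟨ x , (a ∷ p) ⋆ y ⟩ ∎
    where
    open ≡-Reasoning

-- The Cayley–Hamilton theorem for symmetric matrices

module PolyRing where
  open CommutativeRing polyRing public
  open Algebra.Properties.Ring ring public
  open Algebra.Properties.Semiring.Sum semiring public
  open Algebra.Definitions.RawSemiring (RawRing.rawSemiring ℚ[z]) public using (_^_)

module ≃-Reasoning = Relation.Binary.Reasoning.Setoid PolyRing.setoid

-- Laplace expansion along a row r, where f gives the minors and the columns
-- already passed over are kept in reverse order in the first list.
expand : {J : Set} → (List J → Poly) → (J → Poly) → List J → List J → Poly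
expand f r X []      = []
expand f r X (c ∷ Y) = r c *ₚ f (X ʳ++ Y) +ₚ -ₚ expand f r (c ∷ X) Y

-- The entries of a row are indexed by J, and the second list selects the columns.
detᴸ : {J : Set} → List (J → Poly) → List J → Poly
detᴸ []       []      = const 1ℚ
detᴸ []       (_ ∷ _) = []
detᴸ (r ∷ rs) L       = expand (detᴸ rs) r [] L

-- The prefix is reversed because `expand` passes its columns to the minors in this shape.
Alternating : {J : Set} → (List J → Poly) → Set
Alternating f = ∀ X a b Y → f (X ʳ++ (a ∷ b ∷ Y)) ≃ -ₚ f (X ʳ++ (b ∷ a ∷ Y))

expand-step : ∀ x {y y′ z z′} → y ≃ -ₚ y′ → z ≃ -ₚ z′ → x *ₚ y +ₚ -ₚ z ≃ -ₚ (x *ₚ y′ +ₚ -ₚ z′)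
expand-step x {y} {y′} {z} {z′} e f = begin
  x *ₚ y +ₚ -ₚ z              ≈⟨ +ₚ-cong (*ₚ-congˡ x e) (-ₚ-cong f) ⟩
  x *ₚ -ₚ y′ +ₚ -ₚ (-ₚ z′)    ≈⟨ +ₚ-cong (PolyRing.-‿distribʳ-* x y′) ≃-refl ⟨
  -ₚ (x *ₚ y′) +ₚ -ₚ (-ₚ z′)  ≈⟨ PolyRing.-‿+-comm (x *ₚ y′) (-ₚ z′) ⟩
  -ₚ (x *ₚ y′ +ₚ -ₚ z′)       ∎
  where open ≃-Reasoning

module _ {J : Set} {f : List J → Poly} (f-alt : Alternating f) (r : J → Poly) where

  -- Both columns have been passed over, so every remaining minor contains both and changes sign by
  -- `f-alt`. Passed columns are stored in reverse, hence `b` before `a` on the left.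
  expand-swap-passed : ∀ X a b Z Y →
    expand f r (Z ++ b ∷ a ∷ X) Y ≃ -ₚ expand f r (Z ++ a ∷ b ∷ X) Y
  expand-swap-passed X a b Z []      = ≃-refl
  expand-swap-passed X a b Z (c ∷ Y) = expand-step (r c)
    (subst₂ (λ K L → f K ≃ -ₚ f L)
      (sym (++-ʳ++ Z {b ∷ a ∷ X} {Y})) (sym (++-ʳ++ Z {a ∷ b ∷ X} {Y}))
      (f-alt X a b (Z ʳ++ Y)))
    (expand-swap-passed X a b (c ∷ Z) Y)

  -- When the expansion reaches the two columns, deleting one leaves the other in the same place, so
  -- their two terms trade places; the alternating sign of the expansion makes this a negation.
  -- Terms before and after contain both columns in the minor.
  expand-swap : ∀ X Z a b Y →
    expand f r X (Z ++ a ∷ b ∷ Y) ≃ -ₚ expand f r X (Z ++ b ∷ a ∷ Y)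
  expand-swap X []      a b Y = begin
    ra *ₚ fb +ₚ -ₚ (rb *ₚ fa +ₚ -ₚ z)         ≈⟨ +ₚ-cong {ra *ₚ fb} ≃-refl (-ₚ-cong (+ₚ-cong {rb *ₚ fa} ≃-refl (-ₚ-cong (expand-swap-passed X a b [] Y)))) ⟩
    ra *ₚ fb +ₚ -ₚ (rb *ₚ fa +ₚ -ₚ (-ₚ z′))   ≈⟨ lemma (ra *ₚ fb) (rb *ₚ fa) z′ ⟩
    -ₚ (rb *ₚ fa +ₚ -ₚ (ra *ₚ fb +ₚ -ₚ z′))   ∎
    where
    open ≃-Reasoning
    ra = r a
    rb = r b
    fa = f (X ʳ++ (a ∷ Y))
    fb = f (X ʳ++ (b ∷ Y))
    z  = expand f r (b ∷ a ∷ X) Y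
    z′ = expand f r (a ∷ b ∷ X) Y
    lemma : ∀ u v w → u +ₚ -ₚ (v +ₚ -ₚ (-ₚ w)) ≃ -ₚ (v +ₚ -ₚ (u +ₚ -ₚ w))
    lemma u v w = begin
      u +ₚ -ₚ (v +ₚ -ₚ (-ₚ w))       ≈⟨ +ₚ-cong {u} ≃-refl (PolyRing.-‿+-comm v (-ₚ (-ₚ w))) ⟨
      u +ₚ (-ₚ v +ₚ -ₚ (-ₚ (-ₚ w)))  ≈⟨ +ₚ-cong {u} ≃-refl (+ₚ-cong {p = -ₚ v} ≃-refl (PolyRing.-‿involutive (-ₚ w))) ⟩
      u +ₚ (-ₚ v +ₚ -ₚ w)            ≈⟨ ≃-trans (≃-sym (+ₚ-assoc u _ _)) (≃-trans (+ₚ-cong (+ₚ-comm u (-ₚ v)) ≃-refl) (+ₚ-assoc (-ₚ v) u _)) ⟩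
      -ₚ v +ₚ (u +ₚ -ₚ w)            ≈⟨ +ₚ-cong {p = -ₚ v} ≃-refl (PolyRing.-‿involutive (u +ₚ -ₚ w)) ⟨
      -ₚ v +ₚ -ₚ (-ₚ (u +ₚ -ₚ w))    ≈⟨ PolyRing.-‿+-comm v _ ⟩
      -ₚ (v +ₚ -ₚ (u +ₚ -ₚ w))       ∎
  expand-swap X (c ∷ Z) a b Y = expand-step (r c)
    (subst₂ (λ K L → f K ≃ -ₚ f L) (ʳ++-ʳ++ Z) (ʳ++-ʳ++ Z) (f-alt (Z ʳ++ X) a b Y))
    (expand-swap (c ∷ X) Z a b Y)

detᴸ-alternating : {J : Set} (rs : List (J → Poly)) → Alternating (detᴸ rs)
detᴸ-alternating []       X a b Y = ≃-trans (nonempty X a (b ∷ Y)) (-ₚ-cong (≃-sym (nonempty X b (a ∷ Y))))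
  where
  nonempty : ∀ X a Y → detᴸ [] (X ʳ++ (a ∷ Y)) ≃ []
  nonempty []      a Y = ≃-refl
  nonempty (x ∷ X) a Y = nonempty X x (a ∷ Y)
detᴸ-alternating (r ∷ rs) X a b Y =
  subst₂ (λ K L → detᴸ (r ∷ rs) K ≃ -ₚ detᴸ (r ∷ rs) L) (sym (ʳ++-defn X)) (sym (ʳ++-defn X))
         (expand-swap (detᴸ-alternating rs) r [] (List.reverse X) a b Y)

-- Turns a change of sign under swaps into vanishing at equal columns, since 2 is invertible in ℚ.
self-negative⇒zero : ∀ {p} → p ≃ -ₚ p → p ≃ []
self-negative⇒zero {p} e = mk≃ λ k → 2a≡0⇒a≡0 _ (trans (at e k) (coeff-neg p k))
  where
  open ≡-Reasoning
  2a≡0⇒a≡0 : ∀ a → a ≡ - a → a ≡ 0ℚ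
  2a≡0⇒a≡0 a e = begin
    a              ≡⟨ solve 1 (λ a → a := con ½ :* (a :+ a)) refl a ⟩
    ½ * (a + a)    ≡⟨ cong (λ b → ½ * (a + b)) e ⟩
    ½ * (a + - a)  ≡⟨ cong (½ *_) (+-inverseʳ a) ⟩
    ½ * 0ℚ         ≡⟨ *-zeroʳ ½ ⟩
    0ℚ             ∎

neg≡-1* : ∀ a → - a ≡ - 1ℚ * a
neg≡-1* a = solve 1 (λ a → :- a := con (- 1ℚ) :* a) refl a

reverse-ʳ++ : {J : Set} (X : List J) {Y : List J} → List.reverse X ʳ++ Y ≡ X ++ Y
reverse-ʳ++ X = trans (ʳ++-defn (List.reverse X)) (cong (_++ _) (reverse-involutive X))

module _ {J : Set} (f : List J → Poly) (f-alt : Alternating f) where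

  -- The sign is (-1) to the length of `X`; it is left open because the applications only conclude
  -- that something vanishes.
  move-to-front : ∀ X a Y → f (X ʳ++ (a ∷ Y)) ≃ f (a ∷ (X ʳ++ Y))
                          ⊎ f (X ʳ++ (a ∷ Y)) ≃ -ₚ f (a ∷ (X ʳ++ Y))
  move-to-front []      a Y = inj₁ ≃-refl
  move-to-front (c ∷ X) a Y with move-to-front X a (c ∷ Y)
  ... | inj₁ e = inj₂ (≃-trans (f-alt X c a Y) (-ₚ-cong e))
  ... | inj₂ e = inj₁ (≃-trans (f-alt X c a Y) (≃-trans (-ₚ-cong e) (PolyRing.-‿involutive _)))

  -- With the leading `a` absorbed into the reversed prefix `X ++ a ∷ []`, the second copy moves
  -- past everything to the front. The two copies are then neighbours, and swapping them changes
  -- nothing but the sign.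
  repeated : ∀ a X Y → f (a ∷ (X ʳ++ (a ∷ Y))) ≃ []
  repeated a X Y = subst (λ K → f K ≃ []) (++-ʳ++ X) (moved (move-to-front (X ++ a ∷ []) a Y))
    where
    adjacent : f (a ∷ ((X ++ a ∷ []) ʳ++ Y)) ≃ []
    adjacent = subst (λ K → f (a ∷ K) ≃ []) (sym (++-ʳ++ X))
                     (self-negative⇒zero (f-alt [] a a (X ʳ++ Y)))
    moved : f ((X ++ a ∷ []) ʳ++ (a ∷ Y)) ≃ f (a ∷ ((X ++ a ∷ []) ʳ++ Y))
          ⊎ f ((X ++ a ∷ []) ʳ++ (a ∷ Y)) ≃ -ₚ f (a ∷ ((X ++ a ∷ []) ʳ++ Y)) →
            f ((X ++ a ∷ []) ʳ++ (a ∷ Y)) ≃ []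
    moved (inj₁ e) = ≃-trans e adjacent
    moved (inj₂ e) = ≃-trans e (-ₚ-cong adjacent)

  repeated-∈ : ∀ {a L} → a ∈ L → f (a ∷ L) ≃ []
  repeated-∈ {a} a∈L with ∈-∃++ a∈L
  ... | X , Y , refl =
    subst (λ K → f (a ∷ K) ≃ []) (reverse-ʳ++ X) (repeated a (List.reverse X) Y)

-- Determinants of rows that annihilate a tuple of vectors

module _ {n} (A : Matrix ℚ n) {J} (x : Fin J → Vector ℚ n) where
  open Action A

  -- When all rows annihilate x, this holds for their determinant.  With L all columns
  -- but k, the terms j ≠ k have a repeated column, which leaves det · x_k = 0.
  Contracts : (List (Fin J) → Poly) → Set
  Contracts f = ∀ L i → ∑ (λ j → (f (j ∷ L) ⋆ x j) i) ≡ 0ℚ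

  module _ {f : List (Fin J) → Poly} (f-contr : Contracts f) (r : Fin J → Poly) where

    -- In every term `j` heads the columns of the minor while the row entry `r c` is independent of
    -- `j`, so `r c` comes out of the sum and `f-contr` applies.
    expand-contracts-passed : ∀ X Y i → ∑ (λ j → (expand f r (X ++ j ∷ []) Y ⋆ x j) i) ≡ 0ℚ
    expand-contracts-passed X []      i = ∑-zero _ λ _ → refl
    expand-contracts-passed X (c ∷ Y) i = begin
      ∑ (λ j → ((r c *ₚ f ((X ++ j ∷ []) ʳ++ Y) +ₚ -ₚ rest j) ⋆ x j) i)
        ≡⟨ ∑-cong (λ j → trans (⋆-+ˡ (r c *ₚ f ((X ++ j ∷ []) ʳ++ Y)) (-ₚ rest j) (x j) i)
                          (cong₂ _+_ (trans (⋆-assoc (r c) _ (x j) i)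
                                            (cong (λ K → (r c ⋆ (f K ⋆ x j)) i) (++-ʳ++ X)))
                                     (trans (⋆-neg (rest j) (x j) i) (neg≡-1* _)))) ⟩
      ∑ (λ j → (r c ⋆ (f (j ∷ (X ʳ++ Y)) ⋆ x j)) i + - 1ℚ * (rest j ⋆ x j) i)
        ≡⟨ ∑-+ _ _ ⟩
      ∑ (λ j → (r c ⋆ (f (j ∷ (X ʳ++ Y)) ⋆ x j)) i) + ∑ (λ j → - 1ℚ * (rest j ⋆ x j) i)
        ≡⟨ cong₂ _+_ (trans (sym (⋆-∑ (r c) _ i)) (⋆-0 (r c) (f-contr (X ʳ++ Y)) i))
                     (trans (sym (*-distribˡ-∑ (- 1ℚ) _))
                            (cong (- 1ℚ *_) (expand-contracts-passed (c ∷ X) Y i))) ⟩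
      0ℚ ∎
      where
      open ≡-Reasoning
      rest : Fin J → Poly
      rest j = expand f r (c ∷ X ++ j ∷ []) Y

    -- Expanding at the column `j` itself gives the minor `f L`, the same for all `j`, applied to
    -- the row relation; the other terms keep `j` in the minor.
    expand-contracts : (∀ i → ∑ (λ j → (r j ⋆ x j) i) ≡ 0ℚ) → Contracts (expand f r [])
    expand-contracts r-ann L i = begin
      ∑ (λ j → ((r j *ₚ f L +ₚ -ₚ rest j) ⋆ x j) i)
        ≡⟨ ∑-cong (λ j → trans (⋆-+ˡ (r j *ₚ f L) (-ₚ rest j) (x j) i)
                          (cong₂ _+_ (trans (⋆-congˡ (x j) (*ₚ-comm (r j) (f L)) i) (⋆-assoc (f L) (r j) (x j) i))
                                     (trans (⋆-neg (rest j) (x j) i) (neg≡-1* _)))) ⟩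
      ∑ (λ j → (f L ⋆ (r j ⋆ x j)) i + - 1ℚ * (rest j ⋆ x j) i)
        ≡⟨ ∑-+ _ _ ⟩
      ∑ (λ j → (f L ⋆ (r j ⋆ x j)) i) + ∑ (λ j → - 1ℚ * (rest j ⋆ x j) i)
        ≡⟨ cong₂ _+_ (trans (sym (⋆-∑ (f L) _ i)) (⋆-0 (f L) r-ann i))
                     (trans (sym (*-distribˡ-∑ (- 1ℚ) _))
                            (cong (- 1ℚ *_) (expand-contracts-passed [] L i))) ⟩
      0ℚ ∎
      where
      open ≡-Reasoning
      rest : Fin J → Poly
      rest j = expand f r (j ∷ []) L

  detᴸ-contracts : ∀ rs → (∀ {r} → r ∈ rs → ∀ i → ∑ (λ j → (r j ⋆ x j) i) ≡ 0ℚ) →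
                   Contracts (detᴸ rs)
  detᴸ-contracts []       ann L i = ∑-zero _ λ _ → refl
  detᴸ-contracts (r ∷ rs) ann =
    expand-contracts (detᴸ-contracts rs (ann ∘ there)) r (ann (here refl))

  detᴸ-annihilates : ∀ rs → (∀ {r} → r ∈ rs → ∀ i → ∑ (λ j → (r j ⋆ x j) i) ≡ 0ℚ) →
                     ∀ k i → (detᴸ rs (List.allFin J) ⋆ x k) i ≡ 0ℚ
  detᴸ-annihilates rs ann k i with ∈-∃++ (∈-allFin k)
  ... | X , Y , allFin≡ = subst (λ L → (detᴸ rs L ⋆ x k) i ≡ 0ℚ)
                                (trans (reverse-ʳ++ X) (sym allFin≡))
                                (moved (move-to-front (detᴸ rs) alt (List.reverse X) k Y))
    where
    alt = detᴸ-alternating rs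
    X′ = List.reverse X

    others : ∀ j → j ≢ k → j ∈ X′ ʳ++ Y
    others j j≢k = subst (j ∈_) (sym (reverse-ʳ++ X)) (without (∈-++⁻ X (subst (j ∈_) allFin≡ (∈-allFin j))))
      where
      without : j ∈ X ⊎ j ∈ k ∷ Y → j ∈ X ++ Y
      without (inj₁ j∈X)         = ∈-++⁺ˡ j∈X
      without (inj₂ (here j≡k))  = contradiction j≡k j≢k
      without (inj₂ (there j∈Y)) = ∈-++⁺ʳ X j∈Y

    front : (detᴸ rs (k ∷ (X′ ʳ++ Y)) ⋆ x k) i ≡ 0ℚ
    front = trans (sym (∑-single k _ λ j j≢k →
                     ⋆-annihil (detᴸ rs (j ∷ (X′ ʳ++ Y))) (x j) (repeated-∈ (detᴸ rs) alt (others j j≢k)) i))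
                  (detᴸ-contracts rs ann (X′ ʳ++ Y) i)

    moved : detᴸ rs (X′ ʳ++ (k ∷ Y)) ≃ detᴸ rs (k ∷ (X′ ʳ++ Y))
          ⊎ detᴸ rs (X′ ʳ++ (k ∷ Y)) ≃ -ₚ detᴸ rs (k ∷ (X′ ʳ++ Y)) →
            (detᴸ rs (X′ ʳ++ (k ∷ Y)) ⋆ x k) i ≡ 0ℚ
    moved (inj₁ e) = trans (⋆-congˡ (x k) e i) front
    moved (inj₂ e) = trans (⋆-congˡ (x k) e i) (trans (⋆-neg (detᴸ rs (k ∷ (X′ ʳ++ Y))) (x k) i) (cong -_ front))

-- Comparison with the Laplace expansion over `Fin`

-1^ : ℕ → Poly
-1^ = (-ₚ const 1ℚ) PolyRing.^_

module _ {J : Set} (f : List J → Poly) (r : J → Poly) where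

  -- The nested negations of `expand` multiply out to the explicit signs (-1)^j.
  expand-tabulate : ∀ {m} X (c : Vector J (suc m)) →
    expand f r X (List.tabulate c) ≃
    PolyRing.sum λ j → -1^ (toℕ j) *ₚ (r (c j) *ₚ f (X ʳ++ List.tabulate (removeAt c j)))
  expand-tabulate {zero}  X c = ≃-trans (PolyRing.+-identityʳ _) (≃-sym (≃-trans (PolyRing.+-identityʳ _) (*ₚ-identityˡ _)))
  expand-tabulate {suc m} X c = +ₚ-cong (≃-sym (*ₚ-identityˡ _)) (begin
    -ₚ expand f r (c zero ∷ X) (List.tabulate (c ∘ suc))
      ≈⟨ -ₚ-cong (expand-tabulate (c zero ∷ X) (c ∘ suc)) ⟩
    -ₚ PolyRing.sum term
      ≈⟨ PolyRing.-1*x≈-x _ ⟨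
    (-ₚ const 1ℚ) *ₚ PolyRing.sum term
      ≈⟨ PolyRing.*-distribˡ-sum (-ₚ const 1ℚ) term ⟩
    PolyRing.sum (λ j → (-ₚ const 1ℚ) *ₚ term j)
      ≈⟨ PolyRing.sum-cong-≋ {suc m} (λ j → ≃-sym (*ₚ-assoc (-ₚ const 1ℚ) (-1^ (toℕ j)) (r (c (suc j)) *ₚ f (X ʳ++ List.tabulate (removeAt c (suc j)))))) ⟩
    PolyRing.sum (λ j → -1^ (suc (toℕ j)) *ₚ (r (c (suc j)) *ₚ f (X ʳ++ List.tabulate (removeAt c (suc j)))))
      ∎)
    where
    open ≃-Reasoning
    term : Fin (suc m) → Poly
    term j = -1^ (toℕ j) *ₚ (r (c (suc j)) *ₚ f ((c zero ∷ X) ʳ++ List.tabulate (removeAt (c ∘ suc) j)))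

-- The selection `c` of columns is arbitrary because a minor keeps the rows as functions on all of
-- `J` and only shrinks the selection.
det≃detᴸ : ∀ {J : Set} {n} (r : Vector (J → Poly) n) (c : Vector J n) →
           det (λ i j → r i (c j)) ≃ detᴸ (List.tabulate r) (List.tabulate c)
det≃detᴸ {n = zero}  r c = ≃-refl
det≃detᴸ {n = suc n} r c = ≃-trans
  (PolyRing.sum-cong-≋ {suc n} λ j → *ₚ-congˡ (-1^ (toℕ j)) (*ₚ-congˡ (r zero (c j)) (det≃detᴸ (r ∘ suc) (removeAt c j))))
  (≃-sym (expand-tabulate (detᴸ (List.tabulate (r ∘ suc))) (r zero) [] c))

-- The determinant argument covers the basis vectors. A general `x` follows by moving the polynomial
-- in A across the inner product onto `basis i`.
cayley-hamilton : ∀ {n} (A : Matrix ℚ n) → Symmetricᴹ A →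
                  ∀ x i → Action._⋆_ A (charPoly A) x i ≡ 0ℚ
cayley-hamilton {n} A A-sym x i = begin
  (charPoly A ⋆ x) i               ≡⟨ ∑-basisˡ i (charPoly A ⋆ x) ⟨
  ⟨ basis i , charPoly A ⋆ x ⟩     ≡⟨ ⋆-selfAdjoint A-sym (charPoly A) (basis i) x ⟨
  ⟨ charPoly A ⋆ basis i , x ⟩     ≡⟨ ∑-zero _ (λ j → trans (cong (_* x j) (on-basis i j)) (*-zeroˡ (x j))) ⟩
  0ℚ                               ∎
  where
  open ≡-Reasoning
  open Action A

  rows : Vector (Vector Poly n) n
  rows i j = 𝐳 *ₚ const (identity i j) +ₚ -ₚ const (A i j)

  entry-⋆ : ∀ i j y k → (rows i j ⋆ y) k ≡ basis i j * (A · y) k + - A i j * y k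
  entry-⋆ i j y k = begin
    (rows i j ⋆ y) k
      ≡⟨ ⋆-+ˡ (𝐳 *ₚ const (identity i j)) (-ₚ const (A i j)) y k ⟩
    ((𝐳 *ₚ const (identity i j)) ⋆ y) k + ((-ₚ const (A i j)) ⋆ y) k
      ≡⟨ cong₂ _+_ (⋆-congˡ y (*ₚ-comm 𝐳 (const (identity i j))) k) (⋆-const (- A i j) y k) ⟩
    ((const (identity i j) *ₚ 𝐳) ⋆ y) k + - A i j * y k
      ≡⟨ cong (_+ - A i j * y k) (trans (⋆-assoc (const (identity i j)) 𝐳 y k)
           (trans (⋆-const (identity i j) (𝐳 ⋆ y) k) (cong (identity i j *_) (⋆-𝐳 y k)))) ⟩
    basis i j * (A · y) k + - A i j * y k ∎

  column : ∀ i k → (A · basis i) k ≡ A k i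
  column i k = trans (⟨⟩-comm (A k) (basis i)) (∑-basisˡ i (A k))

  -- The identity part contributes column i of A and the other part subtracts row i; the two agree
  -- by symmetry.
  row-annihilates : ∀ i k → ∑ (λ j → (rows i j ⋆ basis j) k) ≡ 0ℚ
  row-annihilates i k = begin
    ∑ (λ j → (rows i j ⋆ basis j) k)
      ≡⟨ ∑-cong (λ j → entry-⋆ i j (basis j) k) ⟩
    ∑ (λ j → basis i j * (A · basis j) k + - A i j * basis j k)
      ≡⟨ ∑-+ _ _ ⟩
    ∑ (λ j → basis i j * (A · basis j) k) + ∑ (λ j → - A i j * basis j k)
      ≡⟨ cong₂ _+_ (trans (∑-basisˡ i _) (column i k))
                   (trans (∑-single k _ λ j j≢k → trans (cong (- A i j *_) (basis-other j≢k)) (*-zeroʳ (- A i j)))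
                          (trans (cong (- A i k *_) (basis-same k)) (*-identityʳ _))) ⟩
    A k i + - A i k
      ≡⟨ trans (cong (_+ - A i k) (A-sym k i)) (+-inverseʳ (A i k)) ⟩
    0ℚ ∎

  ann : ∀ {r} → r ∈ List.tabulate rows → ∀ k → ∑ (λ j → (r j ⋆ basis j) k) ≡ 0ℚ
  ann r∈rows with ∈-tabulate⁻ r∈rows
  ... | i , refl = row-annihilates i

  on-basis : ∀ k i → (charPoly A ⋆ basis k) i ≡ 0ℚ
  on-basis k i = trans (⋆-congˡ (basis k) (det≃detᴸ rows (λ j → j)) i)
                       (detᴸ-annihilates A basis (List.tabulate rows) ann k i)

-- Degrees and divisibility

-- A strict bound instead of a degree, so that trailing zeros and the zero polynomial need no
-- special treatment.
DegBelow : Poly → ℕ → Set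
DegBelow p d = ∀ k → d ℕ.≤ k → coeff p k ≡ 0ℚ

degBelow-mono : ∀ p {d e} → d ℕ.≤ e → DegBelow p d → DegBelow p e
degBelow-mono p d≤e p<d k e≤k = p<d k (ℕ.≤-trans d≤e e≤k)

degBelow-+ : ∀ p q {d} → DegBelow p d → DegBelow q d → DegBelow (p +ₚ q) d
degBelow-+ p q p<d q<d k d≤k = trans (coeff-+ p q k) (cong₂ _+_ (p<d k d≤k) (q<d k d≤k))

degBelow-zero : ∀ {p} → DegBelow p 0 → p ≃ []
degBelow-zero p<0 = mk≃ λ k → p<0 k z≤n

degBelow-tail : ∀ {a p d} → DegBelow (a ∷ p) (suc d) → DegBelow p d
degBelow-tail p<d k d≤k = p<d (suc k) (s≤s d≤k)

degBelow-∷ : ∀ {a p d} → DegBelow p d → DegBelow (a ∷ p) (suc d)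
degBelow-∷ p<d (suc k) (s≤s d≤k) = p<d k d≤k

degBelow-const : ∀ a → DegBelow (const a) 1
degBelow-const a (suc k) _ = refl

-- A bound `suc d` says that the degree is at most d, and in this form bounds add.
degBelow-* : ∀ p q {d e} → DegBelow p (suc d) → DegBelow q (suc e) → DegBelow (p *ₚ q) (suc (d ℕ.+ e))
degBelow-* []      q         p<d q<e k       d+e<k = refl
degBelow-* (a ∷ p) q {d} {e} p<d q<e (suc k) (s≤s d+e≤k) = begin
  coeff ((a ∷ p) *ₚ q) (suc k)           ≡⟨ coeff-*-suc a p q k ⟩
  a * coeff q (suc k) + coeff (p *ₚ q) k ≡⟨ cong₂ (λ b c → a * b + c) (q<e (suc k) (s≤s (ℕ.≤-trans (ℕ.m≤n+m e d) d+e≤k))) (rest d p<d d+e≤k) ⟩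
  a * 0ℚ + 0ℚ                            ≡⟨ trans (ℚ.+-identityʳ _) (ℚ.*-zeroʳ a) ⟩
  0ℚ                                     ∎
  where
  open ≡-Reasoning
  rest : ∀ d → DegBelow (a ∷ p) (suc d) → d ℕ.+ e ℕ.≤ k → coeff (p *ₚ q) k ≡ 0ℚ
  rest zero    p<1 _   = at (*ₚ-annihilˡ p q (degBelow-zero (degBelow-tail p<1))) k
  rest (suc d) p<d d<k = degBelow-* p q (degBelow-tail p<d) q<e k d<k

coeff-*-top : ∀ p q {d e} → DegBelow p (suc d) → DegBelow q (suc e) →
              coeff (p *ₚ q) (d ℕ.+ e) ≡ coeff p d * coeff q e
coeff-*-top []      q {d}     {e}     p<d q<e = sym (ℚ.*-zeroˡ (coeff q e))
coeff-*-top (a ∷ p) q {zero}  {zero}  p<1 q<e = coeff-*-zero a p q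
coeff-*-top (a ∷ p) q {zero}  {suc e} p<1 q<e =
  trans (coeff-*-suc a p q e)
        (trans (cong (a * coeff q (suc e) +_)
                     (at (*ₚ-annihilˡ p q (degBelow-zero (degBelow-tail p<1))) e))
               (ℚ.+-identityʳ _))
coeff-*-top (a ∷ p) q {suc d} {e}     p<d q<e = begin
  coeff ((a ∷ p) *ₚ q) (suc (d ℕ.+ e))
    ≡⟨ coeff-*-suc a p q (d ℕ.+ e) ⟩
  a * coeff q (suc (d ℕ.+ e)) + coeff (p *ₚ q) (d ℕ.+ e)
    ≡⟨ cong₂ (λ b c → a * b + c) (q<e _ (s≤s (ℕ.m≤n+m e d))) (coeff-*-top p q (degBelow-tail p<d) q<e) ⟩
  a * 0ℚ + coeff p d * coeff q e
    ≡⟨ trans (cong (_+ coeff p d * coeff q e) (ℚ.*-zeroʳ a)) (ℚ.+-identityˡ _) ⟩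
  coeff p d * coeff q e ∎
  where open ≡-Reasoning

degBelow-sum : ∀ {n d} (t : Vector Poly n) → (∀ i → DegBelow (t i) d) → DegBelow (PolyRing.sum t) d
degBelow-sum {zero}  t t<d k d≤k = refl
degBelow-sum {suc n} t t<d =
  degBelow-+ (t zero) _ (t<d zero) (degBelow-sum (t ∘ suc) (t<d ∘ suc))

degBelow--1^ : ∀ k → DegBelow (-1^ k) 1
degBelow--1^ zero    = degBelow-const 1ℚ
degBelow--1^ (suc k) = degBelow-* (-ₚ const 1ℚ) (-1^ k) (degBelow-const (- 1ℚ)) (degBelow--1^ k)

degBelow-det : ∀ {n} (M : Vector (Vector Poly n) n) → (∀ i j → DegBelow (M i j) 2) →
               DegBelow (det M) (suc n)
degBelow-det {zero}  M M<2 = degBelow-const 1ℚ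
degBelow-det {suc n} M M<2 = degBelow-sum term λ j →
  degBelow-* (-1^ (toℕ j)) (M zero j *ₚ minor j) (degBelow--1^ (toℕ j))
    (degBelow-* (M zero j) (minor j) (M<2 zero j)
      (degBelow-det (λ i → removeAt (M (suc i)) j) (λ i k → M<2 (suc i) (punchIn j k))))
  where
  minor term : Fin (suc n) → Poly
  minor j = det λ i → removeAt (M (suc i)) j
  term j  = -1^ (toℕ j) *ₚ (M zero j *ₚ minor j)

-- All minors of size n have degree at most n, and the off-diagonal entries of the first row are
-- constant, so only the diagonal term of the expansion reaches degree n + 1.
det-monic : ∀ {n} (M : Vector (Vector Poly n) n) →
            (∀ i j → DegBelow (M i j) 2) → (∀ i j → i ≢ j → DegBelow (M i j) 1) →
            (∀ i → coeff (M i i) 1 ≡ 1ℚ) → coeff (det M) n ≡ 1ℚ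
det-monic {zero}  M M<2 off diag = refl
det-monic {suc n} M M<2 off diag = begin
  coeff (det M) (suc n)
    ≡⟨ coeff-+ (term zero) _ (suc n) ⟩
  coeff (term zero) (suc n) + coeff (PolyRing.sum (term ∘ suc)) (suc n)
    ≡⟨ cong₂ _+_
         (trans (at (*ₚ-identityˡ (M zero zero *ₚ minor zero)) (suc n))
           (trans (coeff-*-top (M zero zero) (minor zero) (M<2 zero zero) (minor< zero))
             (cong₂ _*_ (diag zero)
               (det-monic (λ i j → M (suc i) (suc j)) (λ i j → M<2 (suc i) (suc j))
                 (λ i j i≢j → off (suc i) (suc j) (i≢j ∘ suc-injective)) (diag ∘ suc)))))
         (degBelow-sum (term ∘ suc) (λ j →
           degBelow-* (-1^ (suc (toℕ j))) _ (degBelow--1^ (suc (toℕ j)))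
             (degBelow-* (M zero (suc j)) (minor (suc j)) (off zero (suc j) λ ()) (minor< (suc j))))
           (suc n) ℕ.≤-refl) ⟩
  1ℚ * 1ℚ + 0ℚ ≡⟨⟩
  1ℚ ∎
  where
  open ≡-Reasoning
  minor term : Fin (suc n) → Poly
  minor j = det λ i → removeAt (M (suc i)) j
  term j  = -1^ (toℕ j) *ₚ (M zero j *ₚ minor j)
  minor< : ∀ j → DegBelow (minor j) (suc n)
  minor< j = degBelow-det (λ i → removeAt (M (suc i)) j) λ i k → M<2 (suc i) (punchIn j k)

module _ {n} (A : Matrix ℚ n) where
  private
    entry : Fin n → Fin n → Poly
    entry i j = 𝐳 *ₚ const (identity i j) +ₚ -ₚ const (A i j)

    coeff-entry-1 : ∀ i j → coeff (entry i j) 1 ≡ identity i j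
    coeff-entry-1 i j = trans (ℚ.+-identityʳ _) (ℚ.*-identityˡ (identity i j))

    entry<2 : ∀ i j → DegBelow (entry i j) 2
    entry<2 i j (suc zero)    (s≤s ())
    entry<2 i j (suc (suc k)) _ = refl

    entry<1 : ∀ i j → i ≢ j → DegBelow (entry i j) 1
    entry<1 i j i≢j (suc zero)    _ = trans (coeff-entry-1 i j) (basis-other i≢j)
    entry<1 i j i≢j (suc (suc k)) _ = refl

  charPoly-degree : DegBelow (charPoly A) (suc n)
  charPoly-degree = degBelow-det entry entry<2

  charPoly-monic : coeff (charPoly A) n ≡ 1ℚ
  charPoly-monic = det-monic entry entry<2 entry<1
                     λ i → trans (coeff-entry-1 i i) (basis-same i)

-- Division with remainder

HasDegree : Poly → ℕ → Set
HasDegree p d = coeff p d ≢ 0ℚ × DegBelow p (suc d)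

degree : ∀ p → p ≃ [] ⊎ ∃ (HasDegree p)
degree []      = inj₁ ≃-refl
degree (a ∷ p) with degree p
... | inj₂ (d , pd≢0 , p<d) = inj₂ (suc d , pd≢0 , degBelow-∷ p<d)
... | inj₁ p≃0 with a ℚ.≟ 0ℚ
...   | yes a≡0 = inj₁ (mk≃ λ { zero → a≡0 ; (suc k) → at p≃0 k })
...   | no  a≢0 = inj₂ (0 , a≢0 , λ { (suc k) _ → at p≃0 k })

*-nonzero : ∀ a b → a ≢ 0ℚ → b ≢ 0ℚ → a * b ≢ 0ℚ
*-nonzero a b a≢0 b≢0 ab≡0 = b≢0 (begin
  b                 ≡⟨ *-identityˡ b ⟨
  1ℚ * b            ≡⟨ cong (_* b) (*-inverseˡ a) ⟨
  1/ a * a * b      ≡⟨ *-assoc (1/ a) a b ⟩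
  1/ a * (a * b)    ≡⟨ cong (1/ a *_) ab≡0 ⟩
  1/ a * 0ℚ         ≡⟨ *-zeroʳ (1/ a) ⟩
  0ℚ                ∎)
  where
  open ≡-Reasoning
  instance _ = ≢-nonZero a≢0

infix 4 _∣ₚ_
_∣ₚ_ : Poly → Poly → Set
p ∣ₚ q = ∃ λ s → q ≃ s *ₚ p

-- With a nonzero cofactor of degree e, the product of the leading coefficients would survive in `q`
-- at e + d.
∣ₚ-degree : ∀ {p q d} → HasDegree p d → p ∣ₚ q → DegBelow q d → q ≃ []
∣ₚ-degree {p} {q} {d} (pd≢0 , p<d) (s , q≃sp) q<d with degree s
... | inj₁ s≃0 = ≃-trans q≃sp (*ₚ-annihilˡ s p s≃0)
... | inj₂ (e , se≢0 , s<e) = contradiction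
  (trans (sym (coeff-*-top s p s<e p<d)) (trans (sym (at q≃sp (e ℕ.+ d))) (q<d (e ℕ.+ d) (ℕ.m≤n+m d e))))
  (*-nonzero _ _ se≢0 pd≢0)

-- From p = s q + r follows a + z p = (z s) q + (a + z r). The new remainder has degree at most d,
-- and subtracting `c` times `q` cancels its coefficient at d.
divide : ∀ {q d} → HasDegree q d → ∀ p → ∃₂ λ s r → p ≃ s *ₚ q +ₚ r × DegBelow r d
divide         qd      []      = [] , [] , ≃-refl , λ _ _ → refl
divide {q} {d} (qd≢0 , q<d) (a ∷ p) with divide (qd≢0 , q<d) p
... | s , r , p≃sq+r , r<d =
  (0ℚ ∷ s) +ₚ const c , (a ∷ r) +ₚ -ₚ (const c *ₚ q) , division , remainder
  where
  instance _ = ≢-nonZero qd≢0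
  c = coeff (a ∷ r) d * 1/ coeff q d

  coeff-cq : ∀ k → coeff (const c *ₚ q) k ≡ c * coeff q k
  coeff-cq zero    = coeff-*-zero c [] q
  coeff-cq (suc k) = trans (coeff-*-suc c [] q k) (ℚ.+-identityʳ _)

  coeff-r : ∀ k → coeff ((a ∷ r) +ₚ -ₚ (const c *ₚ q)) k ≡ coeff (a ∷ r) k + - (c * coeff q k)
  coeff-r k = trans (coeff-+ (a ∷ r) (-ₚ (const c *ₚ q)) k)
                    (cong (coeff (a ∷ r) k +_) (trans (coeff-neg (const c *ₚ q) k) (cong -_ (coeff-cq k))))

  remainder : DegBelow ((a ∷ r) +ₚ -ₚ (const c *ₚ q)) d
  remainder k d≤k with ℕ.m≤n⇒m<n∨m≡n d≤k
  ... | inj₁ d<k = trans (coeff-r k)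
    (trans (cong₂ (λ x y → x + - (c * y)) (degBelow-∷ {a} {r} r<d k d<k) (q<d k d<k))
           (trans (ℚ.+-identityˡ (- (c * 0ℚ))) (cong -_ (*-zeroʳ c))))
  ... | inj₂ refl = trans (coeff-r d) (trans (cong (λ x → coeff (a ∷ r) d + - x) cancel) (+-inverseʳ (coeff (a ∷ r) d)))
    where
    cancel : c * coeff q d ≡ coeff (a ∷ r) d
    cancel = trans (*-assoc (coeff (a ∷ r) d) (1/ coeff q d) (coeff q d))
                   (trans (cong (coeff (a ∷ r) d *_) (*-inverseˡ (coeff q d))) (*-identityʳ (coeff (a ∷ r) d)))

  division : a ∷ p ≃ ((0ℚ ∷ s) +ₚ const c) *ₚ q +ₚ ((a ∷ r) +ₚ -ₚ (const c *ₚ q))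
  division = ≃-sym (begin
    ((0ℚ ∷ s) +ₚ const c) *ₚ q +ₚ ((a ∷ r) +ₚ -ₚ cq)
      ≈⟨ +ₚ-cong (*ₚ-distribʳ q (0ℚ ∷ s) (const c)) (+ₚ-comm (a ∷ r) (-ₚ cq)) ⟩
    ((0ℚ ∷ s) *ₚ q +ₚ cq) +ₚ (-ₚ cq +ₚ (a ∷ r))
      ≈⟨ +ₚ-assoc ((0ℚ ∷ s) *ₚ q) cq _ ⟩
    (0ℚ ∷ s) *ₚ q +ₚ (cq +ₚ (-ₚ cq +ₚ (a ∷ r)))
      ≈⟨ +ₚ-cong {(0ℚ ∷ s) *ₚ q} ≃-refl
           (≃-trans (≃-sym (+ₚ-assoc cq (-ₚ cq) (a ∷ r))) (+ₚ-cong {q = a ∷ r} (PolyRing.-‿inverseʳ cq) ≃-refl)) ⟩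
    (0ℚ ∷ s) *ₚ q +ₚ (a ∷ r)
      ≈⟨ +ₚ-cong {q = a ∷ r} (shift-*ₚ s q) ≃-refl ⟩
    (0ℚ + a) ∷ (s *ₚ q +ₚ r)
      ≈⟨ mk≃ (λ { zero → ℚ.+-identityˡ a ; (suc k) → sym (at p≃sq+r k) }) ⟩
    a ∷ p ∎)
    where
    open ≃-Reasoning
    cq = const c *ₚ q

-- Polynomials annihilating a vector

module _ {n} (A : Matrix ℚ n) (y : Vector ℚ n) where
  open Action A

  Annihilates : Poly → Set
  Annihilates p = ∀ i → (p ⋆ y) i ≡ 0ℚ

  annihilates-remainder : ∀ {p q} s r → p ≃ s *ₚ q +ₚ r → Annihilates p → Annihilates q → Annihilates r
  annihilates-remainder {p} {q} s r e py≡0 qy≡0 i = begin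
    (r ⋆ y) i                        ≡⟨ ℚ.+-identityˡ _ ⟨
    0ℚ + (r ⋆ y) i                   ≡⟨ cong (_+ (r ⋆ y) i) (trans (⋆-assoc s q y i) (⋆-0 s qy≡0 i)) ⟨
    ((s *ₚ q) ⋆ y) i + (r ⋆ y) i     ≡⟨ ⋆-+ˡ (s *ₚ q) r y i ⟨
    ((s *ₚ q +ₚ r) ⋆ y) i            ≡⟨ ⋆-congˡ y e i ⟨
    (p ⋆ y) i                        ≡⟨ py≡0 i ⟩
    0ℚ                               ∎
    where open ≡-Reasoning

  -- Euclid's algorithm, with `d` as fuel. Each remainder inherits annihilation from the two
  -- polynomials before it, so the common divisor reached at the end annihilates too.
  annihilating-gcd : ∀ d p q → DegBelow q d → Annihilates p → Annihilates q →
                     ∃ λ g → g ∣ₚ p × g ∣ₚ q × Annihilates g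
  annihilating-gcd d p q q<d py≡0 qy≡0 with degree q
  ... | inj₁ q≃0 = p , (const 1ℚ , ≃-sym (*ₚ-identityˡ p)) , ([] , q≃0) , py≡0
  annihilating-gcd zero    p q q<0 py≡0 qy≡0 | inj₂ (e , qe≢0 , _) = contradiction (q<0 e z≤n) qe≢0
  annihilating-gcd (suc d) p q q<d py≡0 qy≡0 | inj₂ (e , qe≢0 , q<e)
    with divide (qe≢0 , q<e) p
  ... | s , r , p≃sq+r , r<e
    with annihilating-gcd d q r (degBelow-mono r e≤d r<e) qy≡0 (annihilates-remainder s r p≃sq+r py≡0 qy≡0)
    where
    e≤d : e ℕ.≤ d
    e≤d with e ℕ.≤? d
    ... | yes e≤d = e≤d
    ... | no  e≰d = contradiction (q<d e (ℕ.≰⇒> e≰d)) qe≢0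
  ... | g , (a , q≃ag) , (b , r≃bg) , gy≡0 = g , (s *ₚ a +ₚ b , p≃) , (a , q≃ag) , gy≡0
    where
    open ≃-Reasoning
    p≃ : p ≃ (s *ₚ a +ₚ b) *ₚ g
    p≃ = begin
      p                        ≈⟨ p≃sq+r ⟩
      s *ₚ q +ₚ r              ≈⟨ +ₚ-cong (*ₚ-congˡ s q≃ag) r≃bg ⟩
      s *ₚ (a *ₚ g) +ₚ b *ₚ g  ≈⟨ +ₚ-cong (*ₚ-assoc s a g) ≃-refl ⟨
      s *ₚ a *ₚ g +ₚ b *ₚ g    ≈⟨ *ₚ-distribʳ g (s *ₚ a) b ⟨
      (s *ₚ a +ₚ b) *ₚ g       ∎

  -- Let g be the common divisor of P and p that annihilates y, and P = a g. If g is a unit, then y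
  -- = 0; so a is a unit, and P divides g and with it p.
  irreducible-∣ : ∀ {P} → IrreducibleOverℚ P → Annihilates P → ¬ (∀ i → y i ≡ 0ℚ) →
                  ∀ p → Annihilates p → P ∣ₚ p
  irreducible-∣ {P} irr Py≡0 y≢0 p py≡0
    with annihilating-gcd (List.length p) P p (degBelow-length p) Py≡0 py≡0
    where
    degBelow-length : ∀ p → DegBelow p (List.length p)
    degBelow-length []      k       _         = refl
    degBelow-length (a ∷ p) (suc k) (s≤s l≤k) = degBelow-length p k l≤k
  ... | g , (a , P≃ag) , (b , p≃bg) , gy≡0
    with Irreducible.split-∣1 irr {a} {g} (at P≃ag)
  ... | inj₂ g∣1 = contradiction vanishes y≢0
    where
    open ≡-Reasoning
    h = quotient g∣1
    vanishes : ∀ i → y i ≡ 0ℚ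
    vanishes i = begin
      y i                      ≡⟨ *-identityˡ (y i) ⟨
      1ℚ * y i                 ≡⟨ ⋆-const 1ℚ y i ⟨
      (const 1ℚ ⋆ y) i         ≡⟨ ⋆-congˡ y (mk≃ {h *ₚ g} {const 1ℚ} (equality g∣1)) i ⟨
      ((h *ₚ g) ⋆ y) i         ≡⟨ ⋆-assoc h g y i ⟩
      (h ⋆ (g ⋆ y)) i          ≡⟨ ⋆-0 h gy≡0 i ⟩
      0ℚ                       ∎
  ... | inj₁ a∣1 = b *ₚ h , (begin
      p                        ≈⟨ p≃bg ⟩
      b *ₚ g                   ≈⟨ *ₚ-congˡ b (*ₚ-identityˡ g) ⟨
      b *ₚ (const 1ℚ *ₚ g)     ≈⟨ *ₚ-congˡ b (*ₚ-congʳ g (mk≃ {h *ₚ a} (equality a∣1))) ⟨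
      b *ₚ (h *ₚ a *ₚ g)       ≈⟨ *ₚ-congˡ b (*ₚ-assoc h a g) ⟩
      b *ₚ (h *ₚ (a *ₚ g))     ≈⟨ *ₚ-congˡ b (*ₚ-congˡ h P≃ag) ⟨
      b *ₚ (h *ₚ P)            ≈⟨ *ₚ-assoc b h P ⟨
      b *ₚ h *ₚ P              ∎)
    where
    open ≃-Reasoning
    h = quotient a∣1

-- Linear dependence and cyclic vectors

dependent : ∀ n (X : Vector (Vector ℚ n) (suc n)) →
            ∃ λ (c : Vector ℚ (suc n)) → (∃ λ i → c i ≢ 0ℚ) × (∀ k → ∑ (λ i → c i * X i k) ≡ 0ℚ)
dependent zero    X = (λ _ → 1ℚ) , (zero , λ ()) , λ ()
dependent (suc n) X with any? (λ p → ¬? (X p zero ℚ.≟ 0ℚ))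
... | no  none with dependent n (λ i k → X (suc i) (suc k))
...   | c , (i , ci≢0) , cX≡0 = c′ , (suc i , ci≢0) , relation
  where
  c′ : Vector ℚ (suc (suc n))
  c′ zero    = 0ℚ
  c′ (suc i) = c i
  relation : ∀ k → ∑ (λ i → c′ i * X i k) ≡ 0ℚ
  relation zero    = ∑-zero _ λ i →
    trans (cong (c′ i *_) (decidable-stable (X i zero ℚ.≟ 0ℚ) λ X≢0 → none (i , X≢0))) (*-zeroʳ (c′ i))
  relation (suc k) = trans (∑-suc _) (cong₂ _+_ (*-zeroˡ (X zero (suc k))) (cX≡0 k))
dependent (suc n) X | yes (p , Xp≢0)
  with dependent n (λ i k → X p zero * X (punchIn p i) (suc k) + - X (punchIn p i) zero * X p (suc k))
... | c , (i , ci≢0) , cX≡0 = c′ , (punchIn p i , c′i≢0) , relation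
  where
  open ≡-Reasoning
  x  = X p zero
  s  = ∑ λ i → c i * X (punchIn p i) zero
  -- The multiples of the pivot vector that were subtracted from the others, collected.
  cₚ = - s
  c′ : Vector ℚ (suc (suc n))
  c′ = insertAt (λ i → c i * x) p cₚ

  c′i≢0 : c′ (punchIn p i) ≢ 0ℚ
  c′i≢0 e = *-nonzero (c i) x ci≢0 Xp≢0 (trans (sym (insertAt-punchIn _ p cₚ i)) e)

  expanded : ∀ k → ∑ (λ i → c′ i * X i k)
                 ≡ ∑ (λ i → c i * (x * X (punchIn p i) k + - X (punchIn p i) zero * X p k))
  expanded k = begin
    ∑ (λ i → c′ i * X i k)
      ≡⟨ ∑-remove p _ ⟩
    c′ p * X p k + ∑ (λ i → c′ (punchIn p i) * X (punchIn p i) k)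
      ≡⟨ cong₂ _+_ (cong (_* X p k) (insertAt-lookup _ p cₚ))
                   (∑-cong λ i → cong (_* X (punchIn p i) k) (insertAt-punchIn _ p cₚ i)) ⟩
    cₚ * X p k + ∑ (λ i → c i * x * X (punchIn p i) k)
      ≡⟨ cong (_+ ∑ (λ i → c i * x * X (punchIn p i) k))
              (trans (solve 2 (λ s b → :- s :* b := s :* (:- b)) refl s (X p k)) (*-distribʳ-∑ (- X p k) _)) ⟩
    ∑ (λ i → c i * X (punchIn p i) zero * - X p k) + ∑ (λ i → c i * x * X (punchIn p i) k)
      ≡⟨ ∑-+ _ _ ⟨
    ∑ (λ i → c i * X (punchIn p i) zero * - X p k + c i * x * X (punchIn p i) k)
      ≡⟨ ∑-cong (λ i → solve 5 (λ c x y z b → c :* y :* (:- b) :+ c :* x :* z := c :* (x :* z :+ :- y :* b))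
                 refl (c i) x (X (punchIn p i) zero) (X (punchIn p i) k) (X p k)) ⟩
    ∑ (λ i → c i * (x * X (punchIn p i) k + - X (punchIn p i) zero * X p k)) ∎

  relation : ∀ k → ∑ (λ i → c′ i * X i k) ≡ 0ℚ
  relation zero    = trans (expanded zero) (∑-zero _ λ i →
    solve 3 (λ c x y → c :* (x :* y :+ :- y :* x) := con 0ℚ) refl (c i) x (X (punchIn p i) zero))
  relation (suc k) = trans (expanded (suc k)) (cX≡0 k)

-- Iterated application of a matrix

infixr 9 _^_·_
_^_·_ : ∀ {n} → Matrix ℚ n → ℕ → Vector ℚ n → Vector ℚ n
A ^ zero  · x = x
A ^ suc k · x = A · A ^ k · x

module _ {n} (A : Matrix ℚ n) where
  open Action A
  open Linear (·-linear A) using () renaming (T-cong to ·-cong; T-* to ·-*; T-comb to ·-comb)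

  ^-cong : ∀ k {x y} → x ≗ y → A ^ k · x ≗ A ^ k · y
  ^-cong zero    e = e
  ^-cong (suc k) e = ·-cong (^-cong k e)

  ^-* : ∀ k a x → A ^ k · (λ i → a * x i) ≗ λ i → a * (A ^ k · x) i
  ^-* zero    a x i = refl
  ^-* (suc k) a x i = trans (·-cong (^-* k a x) i) (·-* a (A ^ k · x) i)

  ^-sucʳ : ∀ k x → A ^ suc k · x ≗ A ^ k · (A · x)
  ^-sucʳ zero    x i = refl
  ^-sucʳ (suc k) x i = ·-cong (^-sucʳ k x) i

  ⋆-^ : ∀ p k x → p ⋆ (A ^ k · x) ≗ A ^ k · (p ⋆ x)
  ⋆-^ p zero    x i = refl
  ⋆-^ p (suc k) x i = trans (⋆-· p (A ^ k · x) i) (·-cong (⋆-^ p k x) i)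

  ^-selfAdjoint : Symmetricᴹ A → ∀ k x y → ⟨ A ^ k · x , y ⟩ ≡ ⟨ x , A ^ k · y ⟩
  ^-selfAdjoint A-sym zero    x y = refl
  ^-selfAdjoint A-sym (suc k) x y =
    trans (·-selfAdjoint A A-sym (A ^ k · x) y)
          (trans (^-selfAdjoint A-sym k x (A · y))
                 (⟨⟩-cong {x = x} (λ _ → refl) λ i → sym (^-sucʳ k y i)))

  -- Lets a linear relation among x, A x, A² x, ... be read as a polynomial in A applied to x.
  ⋆-tabulate : ∀ {m} (c : Vector ℚ m) x →
               List.tabulate c ⋆ x ≗ λ i → ∑ λ j → c j * (A ^ toℕ j · x) i
  ⋆-tabulate {zero}  c x i = sym (∑-empty _)
  ⋆-tabulate {suc m} c x i = sym (trans (∑-suc _) (cong (c zero * x i +_)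
    (trans (sym (·-comb (c ∘ suc) (λ j → A ^ toℕ j · x) i))
           (·-cong (λ k → sym (⋆-tabulate (c ∘ suc) x k)) i))))

degBelow-tabulate : ∀ {m} (c : Vector ℚ m) → DegBelow (List.tabulate c) m
degBelow-tabulate {zero}  c k       _         = refl
degBelow-tabulate {suc m} c (suc k) (s≤s m≤k) = degBelow-tabulate (c ∘ suc) k m≤k

coeff-tabulate : ∀ {m} (c : Vector ℚ m) j → coeff (List.tabulate c) (toℕ j) ≡ c j
coeff-tabulate c zero    = refl
coeff-tabulate c (suc j) = coeff-tabulate (c ∘ suc) j

charPoly-hasDegree : ∀ {n} (A : Matrix ℚ n) → HasDegree (charPoly A) n
charPoly-hasDegree A = subst (_≢ 0ℚ) (sym (charPoly-monic A)) ℚ.1≢0 , charPoly-degree A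

a-b≡0⇒a≡b : ∀ {a b} → a + - b ≡ 0ℚ → a ≡ b
a-b≡0⇒a≡b {a} {b} e = begin
  a              ≡⟨ solve 2 (λ a b → a := (a :- b) :+ b) refl a b ⟩
  a + - b + b    ≡⟨ cong (_+ b) e ⟩
  0ℚ + b         ≡⟨ +-identityˡ b ⟩
  b              ∎
  where open ≡-Reasoning

-- Both are monic of degree n, so their difference has smaller degree; being a multiple of
-- `charPoly A`, it is zero.
charPoly-∣ : ∀ {n} (A B : Matrix ℚ n) → charPoly A ∣ₚ charPoly B → charPoly A ≃ charPoly B
charPoly-∣ {n} A B (s , Q≃sP) = mk≃ λ k →
  sym (a-b≡0⇒a≡b (trans (sym (coeff-difference k)) (at difference≃0 k)))
  where
  P = charPoly A
  Q = charPoly B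
  difference = Q +ₚ -ₚ P

  coeff-difference : ∀ k → coeff difference k ≡ coeff Q k + - coeff P k
  coeff-difference k = trans (coeff-+ Q (-ₚ P) k) (cong (coeff Q k +_) (coeff-neg P k))

  P∣difference : P ∣ₚ difference
  P∣difference = s +ₚ -ₚ const 1ℚ , ≃-trans
    (+ₚ-cong Q≃sP (≃-sym (PolyRing.-1*x≈-x P)))
    (≃-sym (*ₚ-distribʳ P s (-ₚ const 1ℚ)))

  difference<n : DegBelow difference n
  difference<n k n≤k with ℕ.m≤n⇒m<n∨m≡n n≤k
  ... | inj₁ n<k  = trans (coeff-difference k)
    (cong₂ (λ a b → a + - b) (charPoly-degree B k n<k) (charPoly-degree A k n<k))
  ... | inj₂ refl = trans (coeff-difference n)
    (cong₂ (λ a b → a + - b) (charPoly-monic B) (charPoly-monic A))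

  difference≃0 : difference ≃ []
  difference≃0 = ∣ₚ-degree (charPoly-hasDegree A) P∣difference difference<n

basis≢0 : ∀ {n} (v : Fin n) → ¬ (∀ i → basis v i ≡ 0ℚ)
basis≢0 v e = ℚ.1≢0 (trans (sym (basis-same v)) (e v))

module _ {m n} (A : Matrix ℚ m) (B : Matrix ℚ n) (v : Fin m) (u : Fin n) where
  private
    module A = Action A
    module B = Action B

  -- Each side is the same combination of the numbers in the hypothesis. The induction replaces the
  -- vectors by their images, which shifts both sequences by one.
  ⋆-transfer : ∀ p x y → (∀ k → (A ^ k · x) v ≡ (B ^ k · y) u) → (p A.⋆ x) v ≡ (p B.⋆ y) u
  ⋆-transfer []      x y e = refl
  ⋆-transfer (a ∷ p) x y e = cong₂ (λ b c → a * b + c) (e 0)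
    (trans (sym (A.⋆-· p x v))
      (trans (⋆-transfer p (A · x) (B · y) λ k →
               trans (sym (^-sucʳ A k x v)) (trans (e (suc k)) (^-sucʳ B k y u)))
             (B.⋆-· p y u)))

-- Symmetric matrices with irreducible characteristic polynomial

module IrreducibleMatrix {n} (A : Matrix ℚ n) (A-sym : Symmetricᴹ A) (irr : IrreducibleOverℚ (charPoly A)) where
  open Action A

  annihilator : ∀ {x} → ¬ (∀ i → x i ≡ 0ℚ) → ∀ p → (∀ i → (p ⋆ x) i ≡ 0ℚ) → charPoly A ∣ₚ p
  annihilator {x} x≢0 = irreducible-∣ A x irr (cayley-hamilton A A-sym x) x≢0

  -- Opaque, because unfolding it in the types of later proofs is very slow.
  opaque
    cyclic : ∀ {x} → ¬ (∀ i → x i ≡ 0ℚ) → (y : Vector ℚ n) →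
             ∃₂ λ a p → a ≢ 0ℚ × (∀ i → a * y i ≡ (p ⋆ x) i)
    cyclic {x} x≢0 y with dependent n X
      where
      X : Vector (Vector ℚ n) (suc n)
      -- The vector `y` and n iterates of `x` are n + 1 vectors in ℚ^n, hence dependent.
      X zero    = y
      X (suc j) = A ^ toℕ j · x
    ... | c , (j , cj≢0) , cX≡0 = - c zero , p , c₀≢0 ∘ neg≡0 , λ i → a+b≡0⇒-a≡b (c zero) (y i) ((p ⋆ x) i) (relation i)
      where
      p : Poly
      p = List.tabulate (c ∘ suc)
      relation : ∀ i → c zero * y i + (p ⋆ x) i ≡ 0ℚ
      relation i = trans (cong (c zero * y i +_) (⋆-tabulate A (c ∘ suc) x i))
                         (trans (sym (∑-suc _)) (cX≡0 i))

      neg≡0 : - c zero ≡ 0ℚ → c zero ≡ 0ℚ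
      neg≡0 e = trans (solve 1 (λ a → a := :- (:- a)) refl (c zero)) (cong -_ e)

      a+b≡0⇒-a≡b : ∀ a x b → a * x + b ≡ 0ℚ → - a * x ≡ b
      a+b≡0⇒-a≡b a x b e = begin
        - a * x                ≡⟨ solve 3 (λ a x b → :- a :* x := b :- (a :* x :+ b)) refl a x b ⟩
        b + - (a * x + b)      ≡⟨ cong (λ z → b + - z) e ⟩
        b + 0ℚ                 ≡⟨ +-identityʳ b ⟩
        b                      ∎
        where open ≡-Reasoning

      -- Without `y` the relation would be a polynomial of degree below n that annihilates `x`. It
      -- is a multiple of the characteristic polynomial, so all its coefficients would vanish.
      c₀≢0 : c zero ≢ 0ℚ
      c₀≢0 c₀≡0 = cj≢0 (all-zero j)
        where
        open ≡-Reasoning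
        px≡0 : ∀ i → (p ⋆ x) i ≡ 0ℚ
        px≡0 i = begin
          (p ⋆ x) i                     ≡⟨ +-identityˡ _ ⟨
          0ℚ + (p ⋆ x) i                ≡⟨ cong (_+ (p ⋆ x) i) (trans (cong (_* y i) c₀≡0) (*-zeroˡ (y i))) ⟨
          c zero * y i + (p ⋆ x) i      ≡⟨ relation i ⟩
          0ℚ                            ∎
        p≃0 : p ≃ []
        p≃0 = ∣ₚ-degree (charPoly-hasDegree A) (annihilator x≢0 p px≡0) (degBelow-tabulate (c ∘ suc))
        all-zero : ∀ j → c j ≡ 0ℚ
        all-zero zero    = c₀≡0
        all-zero (suc j) = trans (sym (coeff-tabulate (c ∘ suc) j)) (at p≃0 (toℕ j))

  ⊥-⋆ : ∀ y x → (∀ k → ⟨ y , A ^ k · x ⟩ ≡ 0ℚ) → ∀ p → ⟨ y , p ⋆ x ⟩ ≡ 0ℚ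
  ⊥-⋆ y x y⊥x []      = ∑-zero _ λ i → *-zeroʳ (y i)
  ⊥-⋆ y x y⊥x (a ∷ p) = begin
    ⟨ y , (a ∷ p) ⋆ x ⟩
      ≡⟨ ∑-cong (λ i → solve 4 (λ y a x z → y :* (a :* x :+ z) := a :* (y :* x) :+ y :* z)
                         refl (y i) a (x i) ((A · (p ⋆ x)) i)) ⟩
    ∑ (λ i → a * (y i * x i) + y i * (A · (p ⋆ x)) i)
      ≡⟨ trans (∑-+ _ _) (cong₂ _+_ (sym (*-distribˡ-∑ a _)) (⟨⟩-cong {x = y} (λ _ → refl) λ i → sym (⋆-· p x i))) ⟩
    a * ⟨ y , x ⟩ + ⟨ y , p ⋆ (A · x) ⟩
      ≡⟨ cong₂ (λ b c → a * b + c) (y⊥x 0) (⊥-⋆ y (A · x) (λ k →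
           trans (⟨⟩-cong {x = y} (λ _ → refl) λ i → sym (^-sucʳ A k x i)) (y⊥x (suc k))) p) ⟩
    a * 0ℚ + 0ℚ
      ≡⟨ trans (+-identityʳ _) (*-zeroʳ a) ⟩
    0ℚ ∎
    where open ≡-Reasoning

  -- By `cyclic`, a nonzero multiple of each basis vector has the form p(A) x, and `y` is orthogonal
  -- to all of these.
  orthogonal : ∀ {x} y → ¬ (∀ i → x i ≡ 0ℚ) → (∀ k → ⟨ y , A ^ k · x ⟩ ≡ 0ℚ) → ∀ i → y i ≡ 0ℚ
  orthogonal {x} y x≢0 y⊥x i = vanishes (cyclic x≢0 (basis i))
    where
    open ≡-Reasoning
    vanishes : (∃₂ λ a p → a ≢ 0ℚ × (∀ j → a * basis i j ≡ (p ⋆ x) j)) → y i ≡ 0ℚ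
    vanishes (a , p , a≢0 , aeᵢ≡px) = decidable-stable (y i ℚ.≟ 0ℚ) λ yi≢0 → *-nonzero a (y i) a≢0 yi≢0 (begin
      a * y i                           ≡⟨ cong (a *_) (∑-basisˡ i y) ⟨
      a * ⟨ basis i , y ⟩               ≡⟨ *-distribˡ-∑ a (λ j → basis i j * y j) ⟩
      ∑ (λ j → a * (basis i j * y j))   ≡⟨ ∑-cong (λ j → trans (sym (*-assoc a (basis i j) (y j)))
                                                       (trans (cong (_* y j) (aeᵢ≡px j)) (*-comm ((p ⋆ x) j) (y j)))) ⟩
      ⟨ y , p ⋆ x ⟩                     ≡⟨ ⊥-⋆ y x y⊥x p ⟩
      0ℚ                                ∎)

  -- The entry of Q(A) A^k x at `v` is a combination of the given numbers, hence equal to the entry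
  -- of Q(B) B^k y at `u`. For Q = P_B the latter is zero by Cayley-Hamilton for B.
  charPoly-determined : ∀ (B : Matrix ℚ n) → Symmetricᴹ B → ∀ v u {x} y → ¬ (∀ i → x i ≡ 0ℚ) →
    (∀ k → (A ^ k · x) v ≡ (B ^ k · y) u) → charPoly A ≃ charPoly B
  charPoly-determined B B-sym v u {x} y x≢0 e =
    charPoly-∣ A B (annihilator x≢0 Q (orthogonal (Q ⋆ x) (basis≢0 v) λ k → begin
      ⟨ Q ⋆ x , A ^ k · basis v ⟩    ≡⟨ ^-selfAdjoint A A-sym k (Q ⋆ x) (basis v) ⟨
      ⟨ A ^ k · (Q ⋆ x) , basis v ⟩  ≡⟨ ⟨⟩-comm (A ^ k · (Q ⋆ x)) (basis v) ⟩
      ⟨ basis v , A ^ k · (Q ⋆ x) ⟩  ≡⟨ ∑-basisˡ v (A ^ k · (Q ⋆ x)) ⟩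
      (A ^ k · (Q ⋆ x)) v            ≡⟨ ⋆-^ A Q k x v ⟨
      (Q ⋆ (A ^ k · x)) v            ≡⟨ ⋆-transfer A B v u Q (A ^ k · x) (B ^ k · y) (shifted k) ⟩
      (Action._⋆_ B Q (B ^ k · y)) u ≡⟨ cayley-hamilton B B-sym (B ^ k · y) u ⟩
      0ℚ                             ∎))
    where
    open ≡-Reasoning
    Q = charPoly B
    shifted : ∀ k l → (A ^ l · (A ^ k · x)) v ≡ (B ^ l · (B ^ k · y)) u
    shifted k l = trans (^-+ A l k x v) (trans (e (l ℕ.+ k)) (sym (^-+ B l k y u)))
      where
      ^-+ : ∀ (M : Matrix ℚ n) l k z → M ^ l · (M ^ k · z) ≗ M ^ (l ℕ.+ k) · z
      ^-+ M zero    k z i = refl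
      ^-+ M (suc l) k z i = Linear.T-cong (·-linear M) (^-+ M l k z) i

  powers-separate : ∀ {x} v u → ¬ (∀ i → x i ≡ 0ℚ) →
                    (∀ k → (A ^ k · x) v ≡ (A ^ k · x) u) → v ≡ u
  powers-separate {x} v u x≢0 e with v ≟ u
  ... | yes v≡u = v≡u
  ... | no  v≢u = contradiction (begin
    1ℚ                             ≡⟨ cong₂ (λ a b → a + - b) (basis-same v) (basis-other (v≢u ∘ sym)) ⟨
    basis v v + - basis u v        ≡⟨ orthogonal (λ i → basis v i + - basis u i) x≢0 perp v ⟩
    0ℚ                             ∎) ℚ.1≢0
    where
    open ≡-Reasoning
    perp : ∀ k → ⟨ (λ i → basis v i + - basis u i) , A ^ k · x ⟩ ≡ 0ℚ
    perp k = begin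
      ⟨ (λ i → basis v i + - basis u i) , z ⟩                ≡⟨ ∑-cong (λ i → solve 3 (λ a b c → (a :- b) :* c := a :* c :+ b :* (:- c))
                                                                           refl (basis v i) (basis u i) (z i)) ⟩
      ∑ (λ i → basis v i * z i + basis u i * - z i)          ≡⟨ ∑-+ _ _ ⟩
      ⟨ basis v , z ⟩ + ⟨ basis u , (λ i → - z i) ⟩          ≡⟨ cong₂ _+_ (∑-basisˡ v z) (∑-basisˡ u (λ i → - z i)) ⟩
      z v + - z u                                            ≡⟨ cong (_+ - z u) (e k) ⟩
      z u + - z u                                            ≡⟨ +-inverseʳ (z u) ⟩
      0ℚ                                                     ∎
      where z = A ^ k · x

  -- Together with `annihilator` this says that ℚ[A] has no zero divisors: a polynomial in A that
  -- kills one nonzero vector kills all.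
  charPoly∣⇒annihilates : ∀ {p} → charPoly A ∣ₚ p → ∀ x i → (p ⋆ x) i ≡ 0ℚ
  charPoly∣⇒annihilates {p} (s , p≃sP) x i =
    trans (⋆-congˡ x p≃sP i)
          (trans (⋆-assoc s (charPoly A) x i) (⋆-0 s (cayley-hamilton A A-sym x) i))

  -- Write a e_u = p e_v with p a polynomial in A.  The moments say that p² e_v = a² e_v,
  -- that is, (a − p) (a + p) e_v = 0, so that e_u = ± e_v since ℚ[A] is a field.
  moments-separate : ∀ v u → (∀ k → (A ^ k · basis v) v ≡ (A ^ k · basis u) u) → v ≡ u
  moments-separate v u e with v ≟ u
  ... | yes v≡u = v≡u
  ... | no  v≢u with cyclic (basis≢0 v) (basis u)
  ...   | a , p , a≢0 , aeᵤ≡peᵥ = contradiction (difference-zero v) difference≢0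
    where
    open ≡-Reasoning
    eᵥ = basis v
    eᵤ = basis u

    sum difference d : Vector ℚ n
    sum        i = a * eᵥ i + a * eᵤ i
    difference i = a * eᵥ i + - (a * eᵤ i)
    d          i = a * (a * eᵥ i) + - (p ⋆ (p ⋆ eᵥ)) i

    t = const a +ₚ -ₚ p

    t⋆ : ∀ x i → (t ⋆ x) i ≡ a * x i + - (p ⋆ x) i
    t⋆ x i = trans (⋆-+ˡ (const a) (-ₚ p) x i) (cong₂ _+_ (⋆-const a x i) (⋆-neg p x i))

    d⊥ : ∀ k → ⟨ d , A ^ k · eᵥ ⟩ ≡ 0ℚ
    d⊥ k = begin
      ⟨ d , z ⟩
        ≡⟨ ∑-cong (λ i → solve 4 (λ a e q z → (a :* (a :* e) :- q) :* z := a :* a :* (e :* z) :+ con (- 1ℚ) :* (q :* z))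
                           refl a (eᵥ i) ((p ⋆ (p ⋆ eᵥ)) i) (z i)) ⟩
      ∑ (λ i → a * a * (eᵥ i * z i) + - 1ℚ * ((p ⋆ (p ⋆ eᵥ)) i * z i))
        ≡⟨ trans (∑-+ _ _) (sym (cong₂ _+_ (*-distribˡ-∑ (a * a) _) (*-distribˡ-∑ (- 1ℚ) _))) ⟩
      a * a * ⟨ eᵥ , z ⟩ + - 1ℚ * ⟨ p ⋆ (p ⋆ eᵥ) , z ⟩
        ≡⟨ cong₂ (λ b c → a * a * b + - 1ℚ * c) (trans (∑-basisˡ v z) (e k)) quadratic ⟩
      a * a * (A ^ k · eᵤ) u + - 1ℚ * (a * a * (A ^ k · eᵤ) u)
        ≡⟨ solve 1 (λ x → x :+ con (- 1ℚ) :* x := con 0ℚ) refl (a * a * (A ^ k · eᵤ) u) ⟩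
      0ℚ ∎
      where
      z = A ^ k · eᵥ
      -- One factor p moves across the inner product, and both sides then contain p e_v = a e_u.
      quadratic : ⟨ p ⋆ (p ⋆ eᵥ) , z ⟩ ≡ a * a * (A ^ k · eᵤ) u
      quadratic = begin
        ⟨ p ⋆ (p ⋆ eᵥ) , z ⟩                ≡⟨ ⋆-selfAdjoint A-sym p (p ⋆ eᵥ) z ⟩
        ⟨ p ⋆ eᵥ , p ⋆ z ⟩                  ≡⟨ ⟨⟩-cong (λ i → sym (aeᵤ≡peᵥ i)) p⋆z ⟩
        ⟨ (λ i → a * eᵤ i) , (λ i → a * (A ^ k · eᵤ) i) ⟩
          ≡⟨ ∑-cong (λ i → solve 3 (λ a e z → a :* e :* (a :* z) := a :* a :* (e :* z)) refl a (eᵤ i) ((A ^ k · eᵤ) i)) ⟩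
        ∑ (λ i → a * a * (eᵤ i * (A ^ k · eᵤ) i))
          ≡⟨ trans (sym (*-distribˡ-∑ (a * a) _)) (cong (a * a *_) (∑-basisˡ u (A ^ k · eᵤ))) ⟩
        a * a * (A ^ k · eᵤ) u              ∎
        where
        p⋆z : ∀ i → (p ⋆ z) i ≡ a * (A ^ k · eᵤ) i
        p⋆z i = begin
          (p ⋆ z) i                       ≡⟨ ⋆-^ A p k eᵥ i ⟩
          (A ^ k · (p ⋆ eᵥ)) i            ≡⟨ ^-cong A k (λ j → sym (aeᵤ≡peᵥ j)) i ⟩
          (A ^ k · (λ j → a * eᵤ j)) i    ≡⟨ ^-* A k a eᵤ i ⟩
          a * (A ^ k · eᵤ) i              ∎

    -- Since `sum` is (a + p) e_v and `t` is a - p, the product is (a² - p²) e_v, which is `d`.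
    t⋆sum≡0 : ∀ i → (t ⋆ sum) i ≡ 0ℚ
    t⋆sum≡0 i = begin
      (t ⋆ sum) i
        ≡⟨ t⋆ sum i ⟩
      a * sum i + - (p ⋆ sum) i
        ≡⟨ cong (λ x → a * sum i + - x)
             (trans (⋆-+ʳ p (λ j → a * eᵥ j) (λ j → a * eᵤ j) i)
                    (cong₂ _+_ (trans (⋆-*ʳ p a eᵥ i) (cong (a *_) (sym (aeᵤ≡peᵥ i)))) (⋆-congʳ p aeᵤ≡peᵥ i))) ⟩
      a * sum i + - (a * (a * eᵤ i) + (p ⋆ (p ⋆ eᵥ)) i)
        ≡⟨ solve 4 (λ a x y q → a :* (a :* x :+ a :* y) :- (a :* (a :* y) :+ q) := a :* (a :* x) :- q)
             refl a (eᵥ i) (eᵤ i) ((p ⋆ (p ⋆ eᵥ)) i) ⟩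
      d i
        ≡⟨ orthogonal d (basis≢0 v) d⊥ i ⟩
      0ℚ ∎

    -- Taking b = a and b = - a shows that `sum` and `difference` both have the nonzero entry a at
    -- v.
    at-v : ∀ b → a * eᵥ v + b * eᵤ v ≡ a
    at-v b = begin
      a * eᵥ v + b * eᵤ v  ≡⟨ cong₂ (λ x y → a * x + b * y) (basis-same v) (basis-other (v≢u ∘ sym)) ⟩
      a * 1ℚ + b * 0ℚ      ≡⟨ solve 2 (λ a b → a :* con 1ℚ :+ b :* con 0ℚ := a) refl a b ⟩
      a                    ∎

    sum≢0 : ¬ (∀ i → sum i ≡ 0ℚ)
    sum≢0 sum≡0 = a≢0 (trans (sym (at-v a)) (sum≡0 v))

    -- As `t` kills the nonzero vector `sum`, it kills e_v as well, and t e_v is `difference`.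
    difference-zero : ∀ i → difference i ≡ 0ℚ
    difference-zero i = begin
      a * eᵥ i + - (a * eᵤ i)  ≡⟨ cong (λ x → a * eᵥ i + - x) (aeᵤ≡peᵥ i) ⟩
      a * eᵥ i + - (p ⋆ eᵥ) i  ≡⟨ t⋆ eᵥ i ⟨
      (t ⋆ eᵥ) i               ≡⟨ charPoly∣⇒annihilates (annihilator sum≢0 t t⋆sum≡0) eᵥ i ⟩
      0ℚ                       ∎

    difference≢0 : difference v ≢ 0ℚ
    difference≢0 diff≡0 = a≢0 (trans (sym (at-v (- a)))
      (trans (cong (a * eᵥ v +_) (sym (neg-distribˡ-* a (eᵤ v)))) diff≡0))

  -- A nonzero multiple of e_u is a combination of the vectors A^k e_v, so these cannot all vanish
  -- at u.
  reaches : ∀ v u → ∃ λ k → (A ^ k · basis v) u ≢ 0ℚ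
  reaches v u with cyclic (basis≢0 v) (basis u)
  ... | a , p , a≢0 , aeᵤ≡peᵥ = some-power p (basis v) λ peᵥ≡0 → a≢0 (begin
    a               ≡⟨ *-identityʳ a ⟨
    a * 1ℚ          ≡⟨ cong (a *_) (basis-same u) ⟨
    a * basis u u   ≡⟨ aeᵤ≡peᵥ u ⟩
    (p ⋆ basis v) u ≡⟨ peᵥ≡0 ⟩
    0ℚ              ∎)
    where
    open ≡-Reasoning
    some-power : ∀ p x → (p ⋆ x) u ≢ 0ℚ → ∃ λ k → (A ^ k · x) u ≢ 0ℚ
    some-power []      x px≢0 = contradiction refl px≢0
    some-power (b ∷ p) x px≢0 with x u ℚ.≟ 0ℚ
    ... | no  x≢0 = 0 , x≢0
    ... | yes x≡0 = map suc (λ {k} Aᵏx≢0 e → Aᵏx≢0 (trans (sym (^-sucʳ A k x u)) e))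
      (some-power p (A · x) λ e → px≢0
        (cong₂ _+_ (trans (cong (b *_) x≡0) (*-zeroʳ b)) (trans (sym (⋆-· p x u)) e)))

-- Walk counts and graph isomorphisms

indicator : {P : Set} → Dec P → ℚ
indicator d = if does d then 1ℚ else 0ℚ

indicator-× : {P Q : Set} (p : Dec P) (q : Dec Q) → indicator (p ×-dec q) ≡ indicator p * indicator q
indicator-× (yes _) q = sym (*-identityˡ _)
indicator-× (no _)  q = sym (*-zeroˡ (indicator q))

indicator-yes : {P : Set} (d : Dec P) → P → indicator d ≡ 1ℚ
indicator-yes (yes _) p = refl
indicator-yes (no ¬p) p = contradiction p ¬p

indicator-no : {P : Set} (d : Dec P) → ¬ P → indicator d ≡ 0ℚ
indicator-no (yes p) ¬p = contradiction p ¬p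
indicator-no (no _)  ¬p = refl

fromℕ : ℕ → ℚ
fromℕ zero    = 0ℚ
fromℕ (suc n) = 1ℚ + fromℕ n

∑ᴸ : {X : Set} → (X → ℚ) → List X → ℚ
∑ᴸ f []       = 0ℚ
∑ᴸ f (x ∷ xs) = f x + ∑ᴸ f xs

module _ {X : Set} where

  ∑ᴸ-cong : {f g : X → ℚ} → f ≗ g → ∀ xs → ∑ᴸ f xs ≡ ∑ᴸ g xs
  ∑ᴸ-cong e []       = refl
  ∑ᴸ-cong e (x ∷ xs) = cong₂ _+_ (e x) (∑ᴸ-cong e xs)

  ∑ᴸ-++ : (f : X → ℚ) → ∀ xs ys → ∑ᴸ f (xs ++ ys) ≡ ∑ᴸ f xs + ∑ᴸ f ys
  ∑ᴸ-++ f []       ys = sym (+-identityˡ _)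
  ∑ᴸ-++ f (x ∷ xs) ys = trans (cong (f x +_) (∑ᴸ-++ f xs ys)) (sym (+-assoc (f x) _ _))

  ∑ᴸ-map : {Y : Set} (f : X → ℚ) (g : Y → X) → ∀ ys → ∑ᴸ f (List.map g ys) ≡ ∑ᴸ (f ∘ g) ys
  ∑ᴸ-map f g []       = refl
  ∑ᴸ-map f g (y ∷ ys) = cong (f (g y) +_) (∑ᴸ-map f g ys)

  ∑ᴸ-*ˡ : ∀ a (f : X → ℚ) xs → ∑ᴸ (λ x → a * f x) xs ≡ a * ∑ᴸ f xs
  ∑ᴸ-*ˡ a f []       = sym (*-zeroʳ a)
  ∑ᴸ-*ˡ a f (x ∷ xs) = trans (cong (a * f x +_) (∑ᴸ-*ˡ a f xs)) (sym (*-distribˡ-+ a (f x) _))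

  ∑ᴸ-cartesian : {Y Z : Set} (f : X → ℚ) (g : Y → Z → X) → ∀ ys zs →
    ∑ᴸ f (cartesianProductWith g ys zs) ≡ ∑ᴸ (λ y → ∑ᴸ (λ z → f (g y z)) zs) ys
  ∑ᴸ-cartesian f g []       zs = refl
  ∑ᴸ-cartesian f g (y ∷ ys) zs =
    trans (∑ᴸ-++ f (List.map (g y) zs) _) (cong₂ _+_ (∑ᴸ-map f (g y) zs) (∑ᴸ-cartesian f g ys zs))

  ∑ᴸ-tabulate : ∀ {n} (f : X → ℚ) (g : Fin n → X) → ∑ᴸ f (List.tabulate g) ≡ ∑ (f ∘ g)
  ∑ᴸ-tabulate {zero}  f g = sym (∑-empty _)
  ∑ᴸ-tabulate {suc n} f g = trans (cong (f (g zero) +_) (∑ᴸ-tabulate f (g ∘ suc))) (sym (∑-suc _))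

  ∑ᴸ-filter : {P : Pred X 0ℓ} (P? : Decidable P) (f : X → ℚ) → ∀ xs →
    ∑ᴸ f (filter P? xs) ≡ ∑ᴸ (λ x → indicator (P? x) * f x) xs
  ∑ᴸ-filter P? f []       = refl
  ∑ᴸ-filter P? f (x ∷ xs) with does (P? x)
  ... | true  = cong₂ _+_ (sym (*-identityˡ (f x))) (∑ᴸ-filter P? f xs)
  ... | false = trans (∑ᴸ-filter P? f xs)
                      (sym (trans (cong (_+ _) (*-zeroˡ (f x))) (+-identityˡ _)))

  fromℕ-length : (xs : List X) → fromℕ (length xs) ≡ ∑ᴸ (λ _ → 1ℚ) xs
  fromℕ-length []       = refl
  fromℕ-length (x ∷ xs) = cong (1ℚ +_) (fromℕ-length xs)

∑ᴸ-allVecs : ∀ {n k} (f : Vec (Fin n) (suc k) → ℚ) →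
             ∑ᴸ f (allVecs n (suc k)) ≡ ∑ λ x → ∑ᴸ (λ xs → f (x ∷ xs)) (allVecs n k)
∑ᴸ-allVecs {n} {k} f = trans (∑ᴸ-cartesian f _∷_ (allFin n) (allVecs n k)) (∑ᴸ-tabulate _ _)

module _ {n} (G : Graph n) where
  open Graph G using (_~_; _~?_; adjacency)

  adjacency≡indicator : ∀ i j → adjacency i j ≡ indicator (i ~? j)
  adjacency≡indicator i j with i ~? j
  ... | yes _ = refl
  ... | no  _ = refl

  adjacency-symmetric : Symmetricᴹ adjacency
  adjacency-symmetric i j with i ~? j | j ~? i
  ... | yes _   | yes _   = refl
  ... | no  _   | no  _   = refl
  ... | yes i~j | no  j≁i = contradiction (Graph.sym G i~j) j≁i
  ... | no  i≁j | yes j~i = contradiction (Graph.sym G j~i) i≁j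

  -- The weight `h` on the last vertex covers both counts: h = 1 gives all walks, and a basis vector
  -- gives those with a prescribed end. Splitting off the first edge is one multiplication by the
  -- adjacency matrix.
  weighted-walks-via : ∀ (h : Fin n → ℚ) k v →
    ∑ᴸ (λ vs → indicator (linked? _~?_ (v ∷ vs)) * h (Vec.last (v ∷ vs))) (allVecs n k)
    ≡ (adjacency ^ k · h) v
  weighted-walks-via h zero    v = trans (+-identityʳ _) (*-identityˡ (h v))
  weighted-walks-via h (suc k) v = begin
    ∑ᴸ (λ vs → indicator (linked? _~?_ (v ∷ vs)) * h (Vec.last (v ∷ vs))) (allVecs n (suc k))
      ≡⟨ ∑ᴸ-allVecs _ ⟩
    ∑ (λ w → ∑ᴸ (λ vs → indicator (linked? _~?_ (v ∷ w ∷ vs)) * h (Vec.last (w ∷ vs))) (allVecs n k))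
      ≡⟨ ∑-cong (λ w → trans (∑ᴸ-cong (step w) (allVecs n k)) (trans (∑ᴸ-*ˡ (adjacency v w) _ (allVecs n k))
           (cong (adjacency v w *_) (weighted-walks-via h k w)))) ⟩
    (adjacency ^ suc k · h) v ∎
    where
    open ≡-Reasoning
    step : ∀ w (vs : Vec (Fin n) k) →
      indicator (linked? _~?_ (v ∷ w ∷ vs)) * h (Vec.last (w ∷ vs))
      ≡ adjacency v w * (indicator (linked? _~?_ (w ∷ vs)) * h (Vec.last (w ∷ vs)))
    step w vs = trans (cong (_* h (Vec.last (w ∷ vs)))
                            (trans (indicator-× (v ~? w) (linked? _~?_ (w ∷ vs)))
                                   (cong (_* indicator (linked? _~?_ (w ∷ vs))) (sym (adjacency≡indicator v w)))))
                      (*-assoc (adjacency v w) _ _)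

  weighted-walks : ∀ (h : Fin n → ℚ) v k →
    ∑ᴸ (h ∘ Vec.last) (walksFrom G v k) ≡ (adjacency ^ k · h) v
  weighted-walks h v k = begin
    ∑ᴸ (h ∘ Vec.last) (walksFrom G v k)
      ≡⟨ ∑ᴸ-filter (λ vs → linked? _~?_ vs ×-dec (Vec.head vs ≟ v)) (h ∘ Vec.last) (allVecs n (suc k)) ⟩
    ∑ᴸ (λ vs → indicator (linked? _~?_ vs ×-dec (Vec.head vs ≟ v)) * h (Vec.last vs)) (allVecs n (suc k))
      ≡⟨ ∑ᴸ-allVecs _ ⟩
    ∑ (λ w → ∑ᴸ (λ vs → indicator (linked? _~?_ (w ∷ vs) ×-dec (w ≟ v)) * h (Vec.last (w ∷ vs))) (allVecs n k))
      ≡⟨ ∑-cong (λ w → trans (∑ᴸ-cong (step w) (allVecs n k)) (trans (∑ᴸ-*ˡ (indicator (w ≟ v)) _ (allVecs n k))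
           (cong (indicator (w ≟ v) *_) (weighted-walks-via h k w)))) ⟩
    ∑ (λ w → indicator (w ≟ v) * (adjacency ^ k · h) w)
      ≡⟨ ∑-single v _ (λ w w≢v → trans (cong (_* (adjacency ^ k · h) w) (indicator-no (w ≟ v) w≢v)) (*-zeroˡ ((adjacency ^ k · h) w))) ⟩
    indicator (v ≟ v) * (adjacency ^ k · h) v
      ≡⟨ trans (cong (_* (adjacency ^ k · h) v) (indicator-yes (v ≟ v) refl)) (*-identityˡ ((adjacency ^ k · h) v)) ⟩
    (adjacency ^ k · h) v ∎
    where
    open ≡-Reasoning
    step : ∀ w (vs : Vec (Fin n) k) →
      indicator (linked? _~?_ (w ∷ vs) ×-dec (w ≟ v)) * h (Vec.last (w ∷ vs))
      ≡ indicator (w ≟ v) * (indicator (linked? _~?_ (w ∷ vs)) * h (Vec.last (w ∷ vs)))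
    step w vs = trans (cong (_* h (Vec.last (w ∷ vs))) (indicator-× (linked? _~?_ (w ∷ vs)) (w ≟ v)))
                      (solve 3 (λ a b c → a :* b :* c := b :* (a :* c)) refl
                             (indicator (linked? _~?_ (w ∷ vs))) (indicator (w ≟ v)) (h (Vec.last (w ∷ vs))))

  walks-count : ∀ v k → fromℕ (length (walksFrom G v k)) ≡ (adjacency ^ k · (λ _ → 1ℚ)) v
  walks-count v k = trans (fromℕ-length (walksFrom G v k)) (weighted-walks (λ _ → 1ℚ) v k)

  closedWalks-count : ∀ v k → fromℕ (length (closedWalksFrom G v k)) ≡ (adjacency ^ k · basis v) v
  closedWalks-count v k = begin
    fromℕ (length (closedWalksFrom G v k))
      ≡⟨ fromℕ-length (closedWalksFrom G v k) ⟩
    ∑ᴸ (λ _ → 1ℚ) (closedWalksFrom G v k)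
      ≡⟨ ∑ᴸ-filter (λ vs → Vec.last vs ≟ v) (λ _ → 1ℚ) (walksFrom G v k) ⟩
    ∑ᴸ (λ vs → indicator (Vec.last vs ≟ v) * 1ℚ) (walksFrom G v k)
      ≡⟨ ∑ᴸ-cong (λ vs → trans (*-identityʳ _) (indicator≡basis (Vec.last vs))) (walksFrom G v k) ⟩
    ∑ᴸ (basis v ∘ Vec.last) (walksFrom G v k)
      ≡⟨ weighted-walks (basis v) v k ⟩
    (adjacency ^ k · basis v) v ∎
    where
    open ≡-Reasoning
    indicator≡basis : ∀ w → indicator (w ≟ v) ≡ basis v w
    indicator≡basis w with w ≟ v
    ... | yes refl = sym (basis-same w)
    ... | no  w≢v  = sym (basis-other (w≢v ∘ sym))

open Graph using (adjacency; Connected)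

-- A nonzero sum has a nonzero summand, whose adjacency factor is the first edge of the path.
power⇒path : ∀ {n} (G : Graph n) v k u → (adjacency G ^ k · basis v) u ≢ 0ℚ → Star (Graph._~_ G) u v
power⇒path G v zero    u eᵥu≢0 with v ≟ u
... | yes refl = ε
... | no  v≢u  = contradiction refl eᵥu≢0
power⇒path G v (suc k) u ne
  with any? (λ w → ¬? (adjacency G u w * (adjacency G ^ k · basis v) w ℚ.≟ 0ℚ))
... | no  none = contradiction (∑-zero _ λ w → decidable-stable (_ ℚ.≟ 0ℚ) λ w≢0 → none (w , w≢0)) ne
... | yes (w , w≢0) with Graph._~?_ G u w
...   | yes u~w = u~w ◅ power⇒path G v k w λ e → w≢0 (trans (cong (1ℚ *_) e) (*-zeroʳ 1ℚ))
...   | no  _   = contradiction (*-zeroˡ ((adjacency G ^ k · basis v) w)) w≢0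

module _ {m n} {G : Graph m} {H : Graph n} (φ : G ≅ H) where
  open _≅_ φ

  adjacency-≅ : ∀ u v → adjacency G u v ≡ adjacency H (to u) (to v)
  adjacency-≅ u v with Graph._~?_ G u v | Graph._~?_ H (to u) (to v)
  ... | yes _   | yes _     = refl
  ... | no  _   | no  _     = refl
  ... | yes u~v | no  φu≁φv = contradiction (Equivalence.to (adjacent u v) u~v) φu≁φv
  ... | no  u≁v | yes φu~φv = contradiction (Equivalence.from (adjacent u v) φu~φv) u≁v

  ^-≅ : ∀ k y v → (adjacency H ^ k · y) (to v) ≡ (adjacency G ^ k · (y ∘ to)) v
  ^-≅ zero    y v = refl
  ^-≅ (suc k) y v = trans (∑-permute _ bijection)
    (∑-cong λ w → cong₂ _*_ (sym (adjacency-≅ v w)) (^-≅ k y w))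

  basis-≅ : ∀ v w → basis (to v) (to w) ≡ basis v w
  basis-≅ v w with v ≟ w
  ... | yes refl = basis-same (to v)
  ... | no  v≢w  = basis-other λ φv≡φw →
    v≢w (trans (sym (inverseˡ bijection)) (trans (cong (bijection ⟨$⟩ˡ_) φv≡φw) (inverseˡ bijection)))

theorem3p1 : (n : ℕ) (G : Graph n) → DeterminedBySpectrum G → IrreducibleOverℚ P[ G ] → (v : Fin n) → Decisive G v
theorem3p1 n G ds irr v = (connected , W-decisive) , (connected , R-decisive)
  where
  A = adjacency G
  open IrreducibleMatrix A (adjacency-symmetric G) irr

  connected : Connected G
  connected u w with reaches w u
  ... | k , ne = power⇒path G w k u ne

  -- The all-ones vector is nonzero only for n > 0, which `v` witnesses.
  1≢0ⱽ : ¬ ((i : Fin n) → 1ℚ ≡ 0ℚ)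
  1≢0ⱽ e = ℚ.1≢0 (e v)

  module _ (H : Graph n) (u : Fin n) where
    B = adjacency H

    -- The isomorphism supplied by the spectrum may send `v` anywhere. The preimage of `u` has the
    -- same sequence as `v`, now within G, and `separate` identifies the two.
    decide : ∀ {x} y → ¬ (∀ i → x i ≡ 0ℚ) → (∀ k → (A ^ k · x) v ≡ (B ^ k · y) u) →
             (∀ (φ : G ≅ H) u′ → _≅_.to φ u′ ≡ u →
                (∀ k → (A ^ k · x) v ≡ (A ^ k · (y ∘ _≅_.to φ)) u′) → v ≡ u′) →
             RootedIso G v H u
    decide {x} y x≢0 e separate = φ ,
      trans (cong to (separate φ u′ φu′≡u λ k →
               trans (e k) (trans (cong (B ^ k · y) (sym φu′≡u)) (^-≅ φ k y u′))))
            φu′≡u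
      where
      φ = ds H (at (charPoly-determined B (adjacency-symmetric H) v u y x≢0 e))
      open _≅_ φ
      u′ = bijection ⟨$⟩ˡ u
      φu′≡u : to u′ ≡ u
      φu′≡u = inverseʳ bijection

  W-decisive : ∀ (H : Graph n) → Connected H → ∀ u → W G v ≗ W H u → RootedIso G v H u
  W-decisive H _ u e = decide H u (λ _ → 1ℚ) 1≢0ⱽ counts λ φ u′ _ → powers-separate v u′ 1≢0ⱽ
    where
    counts : ∀ k → (A ^ k · (λ _ → 1ℚ)) v ≡ (adjacency H ^ k · (λ _ → 1ℚ)) u
    -- The sequences begin at length 1; at length 0 both numbers are 1.
    counts zero    = refl
    counts (suc k) = trans (sym (walks-count G v (suc k)))
                           (trans (cong fromℕ (e k)) (walks-count H u (suc k)))

  R-decisive : ∀ (H : Graph n) → Connected H → ∀ u → R G v ≗ R H u → RootedIso G v H u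
  R-decisive H _ u e = decide H u (basis u) (basis≢0 v) counts
    -- Pulled back along φ, the basis vector of `u` in H becomes that of `u′` in G.
    λ { φ u′ refl e′ → moments-separate v u′ λ k → trans (e′ k) (^-cong A k (basis-≅ φ u′) u′) }
    where
    counts : ∀ k → (A ^ k · basis v) v ≡ (adjacency H ^ k · basis u) u
    counts zero    = trans (basis-same v) (sym (basis-same u))
    counts (suc k) = trans (sym (closedWalks-count G v (suc k)))
                           (trans (cong fromℕ (e k)) (closedWalks-count H u (suc k)))
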